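{- Let $n\ge0$ and let $H_n$ be the pyrene system with $n$ pyrene fragments. Then $$F(H_n,x)=x^{n}\sum_{j=0}^{n}\sum_{i=\lceil\frac{j+n}{2}\rceil}^{n}(-1)^{n-i}2^{2i+j-n}\binom{i}{n-i}\binom{2i-n}{j}x^{j}.$$
   Context: Pyrene system: draw the hexagonal lattice so that every hexagon has two vertical sides; horizontally adjacent hexagons then share a vertical edge. For $n\ge1$, $H_n$ is the hexagonal system (the plane graph formed by the vertices and edges of the following $4n$ hexagons) consisting of a horizontal linear row of $2n$ hexagons $h_{1,1},h_{1,2},\dots,h_{n,1},h_{n,2}$, consecutive ones sharing a vertical edge, together with, for each $i$, a hexagon $s_{i,1}$ directly above and a hexagon $s_{i,2}$ directly below the common edge of $h_{i,1}$ and $h_{i,2}$ (each sharing an edge with both $h_{i,1}$ and $h_{i,2}$). $H_0$ is the null graph (with forcing polynomial $1$). For a perfect matching $M$ of $G$, a forcing set is a subset $S\subseteq M$ contained in no other perfect matching of $G$, and the forcing number $f(G,M)$ is the minimum size of a forcing set. The forcing polynomial is $F(G,x)=\sum_{M\in\mathcal{M}(G)}x^{f(G,M)}$, where $\mathcal{M}(G)$ is the set of perfect matchings of $G$. -}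

module Defs where

open import Data.Bool.Properties using () renaming (_≟_ to _≟ᵇ_)
open import Data.Fin as Fin using (Fin)
import Data.Fin.Properties as Fin
open import Data.Fin.Subset using (Subset; inside; outside; _∈_; _⊆_; ∣_∣)
open import Data.Fin.Subset.Properties using (_∈?_; _⊆?_; anySubset?; ⊆-antisym)
open import Data.Integer using (ℤ; 0ℤ; 1ℤ)
import Data.Integer as ℤ
open import Data.List using (List; []; _∷_; _++_; map; concatMap; filter; foldr; length; lookup; replicate; upTo; deduplicate)
open import Data.List.Extrema.Nat using (min; min≤xs; argmin-sel)
open import Data.List.Membership.Propositional using () renaming (_∈_ to _∈ₗ_)
open import Data.List.Membership.Propositional.Properties using (∈-++⁺ˡ; ∈-++⁺ʳ; ∈-map⁺; ∈-map⁻; ∈-filter⁺; ∈-filter⁻; ∈-deduplicate⁺; ∈-concatMap⁺; ∈-lookup)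
open import Data.List.Relation.Unary.All as All using (All; []; _∷_)
import Data.List.Relation.Unary.All.Properties as All
open import Data.List.Relation.Unary.Any as Any using (here; there)
open import Data.List.Relation.Unary.AllPairs using (_∷_)
open import Data.List.Relation.Unary.Unique.Propositional using (Unique)
import Data.List.Relation.Unary.Unique.DecPropositional.Properties as Unique
open import Data.Nat using (ℕ; zero; suc; _+_; _*_; _∸_; _≤_)
import Data.Nat.Properties as ℕ
open import Data.Product using (∃; _×_; _,_; proj₁; proj₂)
open import Data.Product.Properties using (≡-dec)
open import Data.Sum using (_⊎_; inj₁; inj₂)
open import Data.Vec using ([]; _∷_)
import Data.Vec.Properties as Vec
open import Function using (_∘_)
open import Relation.Binary.Definitions using (DecidableEquality)
open import Relation.Binary.PropositionalEquality using (_≡_; _≢_; refl; sym; trans; cong; subst)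
open import Relation.Nullary using (¬_; Dec; ¬?)
open import Relation.Nullary.Decidable using (map′; _×-dec_; _⊎-dec_; _→-dec_; decidable-stable)

-- Polynomials over ℤ: lists of coefficients, constant term first, compared
-- coefficientwise (so trailing zeros are immaterial).

Poly : Set
Poly = List ℤ

coeff : Poly → ℕ → ℤ
coeff []      _       = 0ℤ
coeff (a ∷ _) zero    = a
coeff (_ ∷ p) (suc k) = coeff p k

infix 4 _≈ₚ_
_≈ₚ_ : Poly → Poly → Set
p ≈ₚ q = ∀ k → coeff p k ≡ coeff q k

infixl 6 _+ₚ_
_+ₚ_ : Poly → Poly → Poly
[]      +ₚ q       = q
(a ∷ p) +ₚ []      = a ∷ p
(a ∷ p) +ₚ (b ∷ q) = (a ℤ.+ b) ∷ (p +ₚ q)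

infixr 7 _·ₚ_
_·ₚ_ : ℤ → Poly → Poly
c ·ₚ p = map (c ℤ.*_) p

infixl 7 _*ₚ_
_*ₚ_ : Poly → Poly → Poly
[]      *ₚ q = []
(a ∷ p) *ₚ q = (a ·ₚ q) +ₚ (0ℤ ∷ (p *ₚ q))

x^_ : ℕ → Poly
x^ k = replicate k 0ℤ ++ (1ℤ ∷ [])

sumₚ : List Poly → Poly
sumₚ = foldr _+ₚ_ []

-- Both bounds are included; the sum is empty when b < a.
∑[_⋯_] : ℕ → ℕ → (ℕ → Poly) → Poly
∑[ a ⋯ b ] f = sumₚ (map (λ k → f (a + k)) (upTo (suc b ∸ a)))

-- Edges are undirected: the order of the two ends in a listed pair is immaterial.
record Graph : Set₁ where
  field
    V        : Set
    _≟ᵥ_     : DecidableEquality V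
    vertices : List V
    edges    : List (V × V)

  Edge : Set
  Edge = Fin (length edges)

  ends : Edge → V × V
  ends = lookup edges

  field
    vertices-unique : Unique vertices
    ends∈vertices   : ∀ e → proj₁ (ends e) ∈ₗ vertices × proj₂ (ends e) ∈ₗ vertices
    no-loop         : ∀ e → proj₁ (ends e) ≢ proj₂ (ends e)
    no-parallel     : ∀ e e′ → ends e ≡ ends e′ ⊎ ends e ≡ (proj₂ (ends e′) , proj₁ (ends e′)) → e ≡ e′

allSubsets : ∀ m → List (Subset m)
allSubsets zero    = [] ∷ []
allSubsets (suc m) = map (outside ∷_) (allSubsets m) ++ map (inside ∷_) (allSubsets m)

∈-allSubsets : ∀ {m} (S : Subset m) → S ∈ₗ allSubsets m
∈-allSubsets []            = here refl
∈-allSubsets (outside ∷ S) = ∈-++⁺ˡ (∈-map⁺ (outside ∷_) (∈-allSubsets S))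
∈-allSubsets (inside  ∷ S) = ∈-++⁺ʳ (map (outside ∷_) (allSubsets _)) (∈-map⁺ (inside ∷_) (∈-allSubsets S))

module Forcing (G : Graph) where
  open Graph G

  EdgeSet : Set
  EdgeSet = Subset (length edges)

  Incident : V → Edge → Set
  Incident v e = v ≡ proj₁ (ends e) ⊎ v ≡ proj₂ (ends e)

  IsMatching : EdgeSet → Set
  IsMatching M = ∀ e e′ → e ∈ M → e′ ∈ M → (∃ λ v → Incident v e × Incident v e′) → e ≡ e′

  IsPerfectMatching : EdgeSet → Set
  IsPerfectMatching M = IsMatching M × All (λ v → ∃ λ e → e ∈ M × Incident v e) vertices

  IsForcingSet : EdgeSet → EdgeSet → Set
  IsForcingSet M S = S ⊆ M × (∀ M′ → IsPerfectMatching M′ → S ⊆ M′ → M′ ≡ M)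

  incident? : ∀ v e → Dec (Incident v e)
  incident? v e = (v ≟ᵥ proj₁ (ends e)) ⊎-dec (v ≟ᵥ proj₂ (ends e))

  meet? : ∀ e e′ → Dec (∃ λ v → Incident v e × Incident v e′)
  meet? e e′ = map′ to from (incident? (proj₁ (ends e)) e′ ⊎-dec incident? (proj₂ (ends e)) e′)
    where
    to : Incident (proj₁ (ends e)) e′ ⊎ Incident (proj₂ (ends e)) e′ → ∃ λ v → Incident v e × Incident v e′
    to (inj₁ p) = _ , inj₁ refl , p
    to (inj₂ p) = _ , inj₂ refl , p
    from : (∃ λ v → Incident v e × Incident v e′) → Incident (proj₁ (ends e)) e′ ⊎ Incident (proj₂ (ends e)) e′
    from (_ , inj₁ refl , p) = inj₁ p
    from (_ , inj₂ refl , p) = inj₂ p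

  isPerfectMatching? : ∀ M → Dec (IsPerfectMatching M)
  isPerfectMatching? M =
    Fin.all? (λ e → Fin.all? λ e′ → (e ∈? M) →-dec ((e′ ∈? M) →-dec (meet? e e′ →-dec (e Fin.≟ e′))))
    ×-dec All.all? (λ v → Fin.any? λ e → (e ∈? M) ×-dec incident? v e) vertices

  isForcingSet? : ∀ M S → Dec (IsForcingSet M S)
  isForcingSet? M S = (S ⊆? M) ×-dec map′ to from (¬? (anySubset? other?))
    where
    Other : EdgeSet → Set
    Other M′ = IsPerfectMatching M′ × S ⊆ M′ × M′ ≢ M

    _≟ₛ_ : DecidableEquality EdgeSet
    _≟ₛ_ = Vec.≡-dec _≟ᵇ_

    other? : ∀ M′ → Dec (Other M′)
    other? M′ = isPerfectMatching? M′ ×-dec ((S ⊆? M′) ×-dec ¬? (M′ ≟ₛ M))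

    to : ¬ ∃ Other → ∀ M′ → IsPerfectMatching M′ → S ⊆ M′ → M′ ≡ M
    to ¬o M′ pm S⊆M′ = decidable-stable (M′ ≟ₛ M) λ M′≢M → ¬o (M′ , pm , (λ {e} → S⊆M′ {e}) , M′≢M)

    from : (∀ M′ → IsPerfectMatching M′ → S ⊆ M′ → M′ ≡ M) → ¬ ∃ Other
    from f (M′ , pm , S⊆M′ , M′≢M) = M′≢M (f M′ pm S⊆M′)

  perfectMatchings : List EdgeSet
  perfectMatchings = filter isPerfectMatching? (allSubsets (length edges))

  forcingSets : EdgeSet → List EdgeSet
  forcingSets M = filter (isForcingSet? M) (allSubsets (length edges))

  -- The default ∣ M ∣ is harmless, as a perfect matching M is one of its own forcing sets.
  forcingNumber : EdgeSet → ℕ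
  forcingNumber M = min ∣ M ∣ (map ∣_∣ (forcingSets M))

  forcingPolynomial : Poly
  forcingPolynomial = sumₚ (map (λ M → x^ forcingNumber M) perfectMatchings)

  self-forcing : ∀ M → IsPerfectMatching M → IsForcingSet M M
  self-forcing M (_ , covers) = (λ e∈M → e∈M) , λ M′ (matching′ , _) M⊆M′ → ⊆-antisym
    (λ {e} e∈M′ →
      let (e₀ , e₀∈M , inc) = All.lookup covers (proj₁ (ends∈vertices e))
      in subst (_∈ M) (sym (matching′ e e₀ e∈M′ (M⊆M′ e₀∈M) (_ , inj₁ refl , inc))) e₀∈M)
    M⊆M′

  forcingNumber-attained : ∀ M → IsPerfectMatching M → ∃ λ S → IsForcingSet M S × ∣ S ∣ ≡ forcingNumber M
  forcingNumber-attained M pm with argmin-sel (λ k → k) ∣ M ∣ (map ∣_∣ (forcingSets M))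
  ... | inj₁ eq = M , self-forcing M pm , sym eq
  ... | inj₂ k∈ =
    let (S , S∈ , eq) = ∈-map⁻ ∣_∣ k∈
    in S , proj₂ (∈-filter⁻ (isForcingSet? M) {xs = allSubsets _} S∈) , sym eq

  forcingNumber-minimal : ∀ M S → IsForcingSet M S → forcingNumber M ≤ ∣ S ∣
  forcingNumber-minimal M S fs = All.lookup (min≤xs ∣ M ∣ (map ∣_∣ (forcingSets M)))
    (∈-map⁺ ∣_∣ (∈-filter⁺ (isForcingSet? M) (∈-allSubsets S) fs))

open Forcing public using (forcingPolynomial)

-- The hexagonal lattice drawn as a brick wall: the zigzag chains of the lattice
-- become the horizontal lines of ℕ × ℕ, and the vertical edges join (x , y) to
-- (x , y + 1) for x + y odd.  A hexagon is given by its lower left vertex (x , y),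
-- x + y odd; its vertical sides lie over x and x + 2.

Point : Set
Point = ℕ × ℕ

_≟ₚ_ : DecidableEquality Point
_≟ₚ_ = ≡-dec ℕ._≟_ ℕ._≟_

Hexagon : Set
Hexagon = Point

hexVertices : Hexagon → List Point
hexVertices (x , y) =
  (x , 1 + y) ∷ (1 + x , 1 + y) ∷ (2 + x , 1 + y) ∷
  (x ,     y) ∷ (1 + x ,     y) ∷ (2 + x ,     y) ∷ []

-- Every edge is directed to the right or upwards, so that an edge common to two
-- hexagons is the same pair in both.
hexEdges : Hexagon → List (Point × Point)
hexEdges (x , y) =
  ((x , 1 + y) , (1 + x , 1 + y)) ∷ ((1 + x , 1 + y) , (2 + x , 1 + y)) ∷
  ((x ,     y) , (1 + x ,     y)) ∷ ((1 + x ,     y) , (2 + x ,     y)) ∷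
  ((x ,     y) , (    x , 1 + y)) ∷ ((2 + x ,     y) , (2 + x , 1 + y)) ∷ []

lookup-injective : ∀ {A : Set} {xs : List A} → Unique xs → ∀ i j → lookup xs i ≡ lookup xs j → i ≡ j
lookup-injective (_  ∷ _)  Fin.zero    Fin.zero    _  = refl
lookup-injective (x∉ ∷ _)  Fin.zero    (Fin.suc j) eq with () ← All.lookup x∉ (∈-lookup j) eq
lookup-injective (x∉ ∷ _)  (Fin.suc i) Fin.zero    eq with () ← All.lookup x∉ (∈-lookup i) (sym eq)
lookup-injective (_  ∷ xs) (Fin.suc i) (Fin.suc j) eq = cong Fin.suc (lookup-injective xs i j eq)

module HexagonalSystem (hs : List Hexagon) where

  vertices : List Point
  vertices = deduplicate _≟ₚ_ (concatMap hexVertices hs)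

  edges : List (Point × Point)
  edges = deduplicate (≡-dec _≟ₚ_ _≟ₚ_) (concatMap hexEdges hs)

  private
    level : Point → ℕ
    level (x , y) = x + y

    Good : Point × Point → Set
    Good (u , v) = level v ≡ suc (level u) × u ∈ₗ vertices × v ∈ₗ vertices

    vertex : ∀ {h u} → h ∈ₗ hs → u ∈ₗ hexVertices h → u ∈ₗ vertices
    vertex h∈ u∈ = ∈-deduplicate⁺ _≟ₚ_ (∈-concatMap⁺ hexVertices (Any.map (λ { refl → u∈ }) h∈))

    good-hex : ∀ {h} → h ∈ₗ hs → All Good (hexEdges h)
    good-hex {x , y} h∈ =
      (refl , v₀ , v₁) ∷ (refl , v₁ , v₂) ∷ (refl , v₃ , v₄) ∷ (refl , v₄ , v₅) ∷
      (ℕ.+-suc x y , v₃ , v₀) ∷ (ℕ.+-suc (2 + x) y , v₅ , v₂) ∷ []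
      where
      v₀ = vertex h∈ (here refl)
      v₁ = vertex h∈ (there (here refl))
      v₂ = vertex h∈ (there (there (here refl)))
      v₃ = vertex h∈ (there (there (there (here refl))))
      v₄ = vertex h∈ (there (there (there (there (here refl)))))
      v₅ = vertex h∈ (there (there (there (there (there (here refl))))))

    good-edges : All Good edges
    good-edges = All.deduplicate⁺ (≡-dec _≟ₚ_ _≟ₚ_)
      (All.concat⁺ (All.map⁺ (All.tabulate good-hex)))

    good : ∀ e → Good (lookup edges e)
    good e = All.lookup good-edges (∈-lookup e)

    no-loop : ∀ e → proj₁ (lookup edges e) ≢ proj₂ (lookup edges e)
    no-loop e eq = ℕ.1+n≢n (trans (sym (proj₁ (good e))) (sym (cong level eq)))

    no-parallel : ∀ e e′ → let (u , v) = lookup edges e; (u′ , v′) = lookup edges e′ in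
      (u , v) ≡ (u′ , v′) ⊎ (u , v) ≡ (v′ , u′) → e ≡ e′
    no-parallel e e′ (inj₁ eq) = lookup-injective (Unique.deduplicate-! (≡-dec _≟ₚ_ _≟ₚ_) (concatMap hexEdges hs)) e e′ eq
    no-parallel e e′ (inj₂ eq) with () ← ℕ.m≢1+n+m _ {1} (trans
      (sym (cong (level ∘ proj₂) eq))
      (trans (proj₁ (good e)) (trans (cong (suc ∘ level ∘ proj₁) eq) (cong suc (proj₁ (good e′))))))

  graph : Graph
  graph = record
    { V               = Point
    ; _≟ᵥ_            = _≟ₚ_
    ; vertices        = vertices
    ; edges           = edges
    ; vertices-unique = Unique.deduplicate-! _≟ₚ_ (concatMap hexVertices hs)
    ; ends∈vertices   = proj₂ ∘ good
    ; no-loop         = no-loop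
    ; no-parallel     = no-parallel
    }

-- The hexagons h₁, h₂, s₁, s₂ of the i-th pyrene fragment, i counted from 0; the
-- common edge of h₁ and h₂ joins (4i+2 , 1) to (4i+2 , 2).
fragment : ℕ → List Hexagon
fragment i =
  (4 * i , 1) ∷ (4 * i + 2 , 1) ∷ (4 * i + 1 , 2) ∷ (4 * i + 1 , 0) ∷ []

pyrene : ℕ → Graph
pyrene n = HexagonalSystem.graph (concatMap fragment (upTo n))

{-# OPTIONS --safe #-}
module Submission where

-- In a perfect matching M of H_n, each of the two middle rows of vertices of each
-- fragment has exactly one vertex of odd abscissa matched inside its row, either
-- to the border of the fragment (outer) or to its centre (inner).  The vertical
-- edges force both rows to go to the same border, or both to the centre.  So M is a
-- word of n letters: end left, end right, or mid a b (two free binary choices), where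
-- end right is never followed by end left, since both would use the common border.
--
-- The forcing number of M is n plus the number of mid letters.  The edges that show
-- the choices (one for an end letter, two for a mid letter) form a forcing set.
-- Conversely, turning one end letter into a mid letter, or flipping one choice of a
-- mid letter, gives another perfect matching; the sets of edges of M lost in these
-- exchanges are disjoint, and every forcing set meets each of them.
--
-- Counting the words gives c(n+2) = (2 + 4x) c(n+1) - c(n), which the summands of the
-- closed form satisfy by Pascal's rule.

open import Defs
open import Data.Nat using (ℕ; _+_; _*_; _∸_; ⌈_/2⌉)
open import Data.Nat.Combinatorics using (_C_)
open import Data.Integer using (+_; -1ℤ) renaming (_*_ to _*ᶻ_; _^_ to _^ᶻ_)

open import Data.Fin as Fin using (Fin; zero; suc; inject₁; toℕ; #_)
open import Data.Fin.Induction using (<-weakInduction)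
import Data.Fin.Properties as Fin
open import Data.Fin.Subset using (Subset; inside; outside; _∈_; _⊆_; ∣_∣; ⁅_⁆; _∪_; _-_; ⊥)
open import Data.Fin.Subset.Properties using (_∈?_; ⊆-antisym; x∈p∪q⁺; x∈p∪q⁻; x∈⁅x⁆; x∈⁅y⁆⇒x≡y; ∉⊥; ∣⊥∣≡0; ∣⁅x⁆∣≡1; x∈p⇒∣p-x∣<∣p∣; x∈p∧x≢y⇒x∈p-y)
open import Data.Integer using (ℤ; 0ℤ; 1ℤ) renaming (_+_ to _+ᶻ_; _-_ to _-ᶻ_)
import Data.Integer.Properties as ℤ
open import Data.Integer.Tactic.RingSolver using (solve-∀)
open import Data.List as List using (List; []; _∷_; _++_; map; concat; concatMap; foldr; length; upTo; applyUpTo; cartesianProductWith)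
import Data.List.Properties as List
open import Data.List.Membership.Propositional using (find; lose) renaming (_∈_ to _∈ₗ_)
open import Data.List.Membership.Propositional.Properties using (∈-lookup; ∈-++⁺ˡ; ∈-++⁺ʳ; ∈-++⁻; ∈-map⁺; ∈-map⁻; ∈-filter⁺; ∈-filter⁻; ∈-cartesianProductWith⁺; ∈-cartesianProductWith⁻; ∈-concat⁺′; ∈-concat⁻′; ∈-concatMap⁺; ∈-concatMap⁻; ∈-deduplicate⁺; ∈-deduplicate⁻; ∈-tabulate⁺; ∈-tabulate⁻; ∈-upTo⁺; ∈-upTo⁻)
open import Data.List.Membership.Propositional.Properties.WithK using (unique∧set⇒bag)
open import Data.List.Relation.Binary.BagAndSetEquality using (∼bag⇒↭)
open import Data.List.Relation.Binary.Permutation.Propositional using (_↭_; prep; swap) renaming (refl to ↭-refl; trans to ↭-trans)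
import Data.List.Relation.Binary.Permutation.Propositional.Properties as ↭
open import Data.List.Relation.Unary.All as All using (All; []; _∷_)
import Data.List.Relation.Unary.All.Properties as All
open import Data.List.Relation.Unary.AllPairs using ([]; _∷_)
import Data.List.Relation.Unary.AllPairs.Properties as AllPairs
open import Data.List.Relation.Unary.Any as Any using (here; there)
import Data.List.Relation.Unary.Any.Properties as Any
open import Data.List.Relation.Unary.Unique.Propositional using (Unique)
import Data.List.Relation.Unary.Unique.Propositional.Properties as Unique
open import Data.Nat using (zero; suc; _≤_; _<_; z≤n; s≤s; _≤?_; _<?_)
open import Data.Nat.Combinatorics using (k>n⇒nCk≡0; nCk+nC[k+1]≡[n+1]C[k+1])
import Data.Nat.Properties as ℕ
import Data.Nat.Tactic.RingSolver as ℕ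
open import Data.Product using (∃; _×_; _,_; proj₁; proj₂)
open import Data.Product.Properties using (≡-dec)
open import Data.Sum using (_⊎_; inj₁; inj₂; [_,_]′)
open import Data.Vec using (Vec; []; _∷_; lookup; tabulate; _[_]≔_)
import Data.Vec.Properties as Vec
open import Function using (_∘_; id; case_of_; mk⇔)
open import Relation.Binary.PropositionalEquality using (_≡_; _≢_; refl; sym; trans; cong; cong₂; subst; module ≡-Reasoning)
open import Relation.Nullary using (¬_; Dec; yes; no; does; ¬?; contradiction)
open import Relation.Nullary.Decidable using (map′; dec-true; decidable-stable; _×-dec_; _⊎-dec_)

-- Coefficients

coeff-+ₚ : ∀ p q k → coeff (p +ₚ q) k ≡ coeff p k +ᶻ coeff q k
coeff-+ₚ []      q       k       = sym (ℤ.+-identityˡ _)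
coeff-+ₚ (a ∷ p) []      k       = sym (ℤ.+-identityʳ _)
coeff-+ₚ (a ∷ p) (b ∷ q) zero    = refl
coeff-+ₚ (a ∷ p) (b ∷ q) (suc k) = coeff-+ₚ p q k

coeff-·ₚ : ∀ c p k → coeff (c ·ₚ p) k ≡ c *ᶻ coeff p k
coeff-·ₚ c []      k       = sym (ℤ.*-zeroʳ c)
coeff-·ₚ c (a ∷ p) zero    = refl
coeff-·ₚ c (a ∷ p) (suc k) = coeff-·ₚ c p k

sumₚ-↭ : ∀ {ps qs} → ps ↭ qs → sumₚ ps ≈ₚ sumₚ qs
sumₚ-↭ ↭-refl          k = refl
sumₚ-↭ {p ∷ ps} {_ ∷ qs} (prep p ps↭) k
  rewrite coeff-+ₚ p (sumₚ ps) k | coeff-+ₚ p (sumₚ qs) k = cong (coeff p k +ᶻ_) (sumₚ-↭ ps↭ k)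
sumₚ-↭ {p ∷ q ∷ ps} {_ ∷ _ ∷ qs} (swap p q ps↭) k
  rewrite coeff-+ₚ p (q +ₚ sumₚ ps) k | coeff-+ₚ q (p +ₚ sumₚ qs) k
        | coeff-+ₚ q (sumₚ ps) k | coeff-+ₚ p (sumₚ qs) k | sumₚ-↭ ps↭ k = exchange (coeff p k) (coeff q k) (coeff (sumₚ qs) k)
  where
  exchange : ∀ a b c → a +ᶻ (b +ᶻ c) ≡ b +ᶻ (a +ᶻ c)
  exchange = solve-∀
sumₚ-↭ (↭-trans p q)   k = trans (sumₚ-↭ p k) (sumₚ-↭ q k)

shift : ℕ → (ℕ → ℤ) → ℕ → ℤ
shift zero    f k       = f k
shift (suc n) f zero    = 0ℤ
shift (suc n) f (suc k) = shift n f k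

shift-cong : ∀ n {f g} → (∀ k → f k ≡ g k) → ∀ k → shift n f k ≡ shift n g k
shift-cong zero    eq k       = eq k
shift-cong (suc n) eq zero    = refl
shift-cong (suc n) eq (suc k) = shift-cong n eq k

shift-+ : ∀ n f g k → shift n (λ j → f j +ᶻ g j) k ≡ shift n f k +ᶻ shift n g k
shift-+ zero    f g k       = refl
shift-+ (suc n) f g zero    = refl
shift-+ (suc n) f g (suc k) = shift-+ n f g k

shift-0 : ∀ n k → shift n (λ _ → 0ℤ) k ≡ 0ℤ
shift-0 zero    k       = refl
shift-0 (suc n) zero    = refl
shift-0 (suc n) (suc k) = shift-0 n k

coeff-x^-*ₚ : ∀ n p k → coeff (x^ n *ₚ p) k ≡ shift n (coeff p) k
coeff-x^-*ₚ zero p k = trans (coeff-+ₚ (1ℤ ·ₚ p) (0ℤ ∷ []) k)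
  (trans (cong₂ _+ᶻ_ (trans (coeff-·ₚ 1ℤ p k) (ℤ.*-identityˡ _)) (zeros k)) (ℤ.+-identityʳ _))
  where
  zeros : ∀ k → coeff (0ℤ ∷ []) k ≡ 0ℤ
  zeros zero    = refl
  zeros (suc k) = refl
coeff-x^-*ₚ (suc n) p k = trans (coeff-+ₚ (0ℤ ·ₚ p) (0ℤ ∷ x^ n *ₚ p) k)
  (trans (cong (_+ᶻ coeff (0ℤ ∷ x^ n *ₚ p) k) (trans (coeff-·ₚ 0ℤ p k) (ℤ.*-zeroˡ (coeff p k)))) (trans (ℤ.+-identityˡ _) (tail k)))
  where
  tail : ∀ k → coeff (0ℤ ∷ x^ n *ₚ p) k ≡ shift (suc n) (coeff p) k
  tail zero    = refl
  tail (suc k) = coeff-x^-*ₚ n p k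

coeff-x^-+ : ∀ n a k → coeff (x^ (n + a)) k ≡ shift n (coeff (x^ a)) k
coeff-x^-+ zero    a k       = refl
coeff-x^-+ (suc n) a zero    = refl
coeff-x^-+ (suc n) a (suc k) = coeff-x^-+ n a k

enumerator : {A : Set} → (A → ℕ) → List A → Poly
enumerator f as = sumₚ (map (λ a → x^ f a) as)

enumerator-shift : ∀ {A : Set} n (f : A → ℕ) as k →
  coeff (enumerator (λ a → n + f a) as) k ≡ shift n (coeff (enumerator f as)) k
enumerator-shift n f []       k = sym (shift-0 n k)
enumerator-shift n f (a ∷ as) k = begin
  coeff (x^ (n + f a) +ₚ enumerator (λ a → n + f a) as) k
    ≡⟨ coeff-+ₚ (x^ (n + f a)) _ k ⟩
  coeff (x^ (n + f a)) k +ᶻ coeff (enumerator (λ a → n + f a) as) k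
    ≡⟨ cong₂ _+ᶻ_ (coeff-x^-+ n (f a) k) (enumerator-shift n f as k) ⟩
  shift n (coeff (x^ f a)) k +ᶻ shift n (coeff (enumerator f as)) k
    ≡⟨ shift-+ n _ _ k ⟨
  shift n (λ j → coeff (x^ f a) j +ᶻ coeff (enumerator f as) j) k
    ≡⟨ shift-cong n (coeff-+ₚ (x^ f a) (enumerator f as)) k ⟨
  shift n (coeff (enumerator f (a ∷ as))) k ∎
  where open ≡-Reasoning

enumerator-++ : ∀ {A : Set} (f : A → ℕ) as bs k →
  coeff (enumerator f (as ++ bs)) k ≡ coeff (enumerator f as) k +ᶻ coeff (enumerator f bs) k
enumerator-++ f []       bs k = sym (ℤ.+-identityˡ _)
enumerator-++ f (a ∷ as) bs k
  rewrite coeff-+ₚ (x^ f a) (enumerator f (as ++ bs)) k | coeff-+ₚ (x^ f a) (enumerator f as) k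
        | enumerator-++ f as bs k = sym (ℤ.+-assoc (coeff (x^ f a) k) _ _)

enumerator-map : ∀ {A B : Set} (f : B → ℕ) (g : A → B) as → enumerator f (map g as) ≡ enumerator (f ∘ g) as
enumerator-map f g as = cong sumₚ (sym (List.map-∘ as))

-- The closed form

sumTo : ℕ → (ℕ → ℤ) → ℤ
sumTo zero    f = 0ℤ
sumTo (suc N) f = f 0 +ᶻ sumTo N (f ∘ suc)

sumTo-cong : ∀ N {f g} → (∀ i → i < N → f i ≡ g i) → sumTo N f ≡ sumTo N g
sumTo-cong zero    eq = refl
sumTo-cong (suc N) eq = cong₂ _+ᶻ_ (eq 0 (s≤s z≤n)) (sumTo-cong N λ i i<N → eq (suc i) (s≤s i<N))

sumTo-0 : ∀ N {f} → (∀ i → i < N → f i ≡ 0ℤ) → sumTo N f ≡ 0ℤ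
sumTo-0 zero    eq = refl
sumTo-0 (suc N) eq = cong₂ _+ᶻ_ (eq 0 (s≤s z≤n)) (sumTo-0 N λ i i<N → eq (suc i) (s≤s i<N))

sumTo-split : ∀ a b f → sumTo (a + b) f ≡ sumTo a f +ᶻ sumTo b (λ i → f (a + i))
sumTo-split zero    b f = sym (ℤ.+-identityˡ _)
sumTo-split (suc a) b f = trans (cong (f 0 +ᶻ_) (sumTo-split a b (f ∘ suc))) (sym (ℤ.+-assoc (f 0) _ _))

sumTo-last : ∀ N f → sumTo (suc N) f ≡ sumTo N f +ᶻ f N
sumTo-last zero    f = ℤ.+-comm (f 0) 0ℤ
sumTo-last (suc N) f = trans (cong (f 0 +ᶻ_) (sumTo-last N (f ∘ suc))) (sym (ℤ.+-assoc (f 0) _ _))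

sumTo-*ʳ : ∀ N f c → sumTo N (λ i → f i *ᶻ c) ≡ sumTo N f *ᶻ c
sumTo-*ʳ zero    f c = sym (ℤ.*-zeroˡ c)
sumTo-*ʳ (suc N) f c = trans (cong (f 0 *ᶻ c +ᶻ_) (sumTo-*ʳ N (f ∘ suc) c)) (sym (ℤ.*-distribʳ-+ c (f 0) _))

sumTo-combine : ∀ N f g h → sumTo N (λ i → (+ 2) *ᶻ f i +ᶻ (+ 4) *ᶻ g i -ᶻ h i) ≡
  (+ 2) *ᶻ sumTo N f +ᶻ (+ 4) *ᶻ sumTo N g -ᶻ sumTo N h
sumTo-combine zero    f g h = refl
sumTo-combine (suc N) f g h = trans (cong ((+ 2) *ᶻ f 0 +ᶻ (+ 4) *ᶻ g 0 -ᶻ h 0 +ᶻ_) (sumTo-combine N (f ∘ suc) (g ∘ suc) (h ∘ suc)))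
  (ring (f 0) (g 0) (h 0) _ _ _)
  where
  ring : ∀ a b c A B C → ((+ 2) *ᶻ a +ᶻ (+ 4) *ᶻ b -ᶻ c) +ᶻ ((+ 2) *ᶻ A +ᶻ (+ 4) *ᶻ B -ᶻ C) ≡
    (+ 2) *ᶻ (a +ᶻ A) +ᶻ (+ 4) *ᶻ (b +ᶻ B) -ᶻ (c +ᶻ C)
  ring = solve-∀

coeff-sum : ∀ N (F : ℕ → Poly) k → coeff (sumₚ (map F (upTo N))) k ≡ sumTo N (λ i → coeff (F i) k)
coeff-sum N F k = go N id
  where
  go : ∀ N (h : ℕ → ℕ) → coeff (sumₚ (map F (applyUpTo h N))) k ≡ sumTo N (λ i → coeff (F (h i)) k)
  go zero    h = refl
  go (suc N) h = trans (coeff-+ₚ (F (h 0)) _ k) (cong (coeff (F (h 0)) k +ᶻ_) (go N (h ∘ suc)))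

sumTo-x^-< : ∀ {N k} (f : ℕ → ℤ) → k < N → sumTo N (λ j → f j *ᶻ coeff (x^ j) k) ≡ f k
sumTo-x^-< {suc N} {zero} f _ = trans
  (cong₂ _+ᶻ_ (ℤ.*-identityʳ (f 0)) (sumTo-0 N λ i _ → ℤ.*-zeroʳ (f (suc i)))) (ℤ.+-identityʳ (f 0))
sumTo-x^-< {suc N} {suc k} f (s≤s k<N) = trans
  (cong₂ _+ᶻ_ (ℤ.*-zeroʳ (f 0)) (sumTo-x^-< (f ∘ suc) k<N)) (ℤ.+-identityˡ _)

sumTo-x^-≥ : ∀ {N k} (f : ℕ → ℤ) → N ≤ k → sumTo N (λ j → f j *ᶻ coeff (x^ j) k) ≡ 0ℤ
sumTo-x^-≥ {zero}          f _         = refl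
sumTo-x^-≥ {suc N} {suc k} f (s≤s N≤k) = cong₂ _+ᶻ_ (ℤ.*-zeroʳ (f 0)) (sumTo-x^-≥ (f ∘ suc) N≤k)

term : ℕ → ℕ → ℕ → ℤ
term n i k =
  (-1ℤ ^ᶻ (n ∸ i)) *ᶻ ((+ 2) ^ᶻ (2 * i + k ∸ n)) *ᶻ (+ (i C (n ∸ i))) *ᶻ (+ ((2 * i ∸ n) C k))

total : ℕ → ℕ → ℤ
total n k = sumTo (suc n) (λ i → term n i k)

term-vanish : ∀ {n i k} → 2 * i < k + n → term n i k ≡ 0ℤ
term-vanish {n} {i} {k} 2i< with n ≤? 2 * i
... | yes n≤ = trans (cong (λ c → a *ᶻ + c) (k>n⇒nCk≡0 small)) (ℤ.*-zeroʳ a)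
  where
  a = (-1ℤ ^ᶻ (n ∸ i)) *ᶻ ((+ 2) ^ᶻ (2 * i + k ∸ n)) *ᶻ (+ (i C (n ∸ i)))
  small : 2 * i ∸ n < k
  small = ℕ.+-cancelʳ-< n _ k (subst (_< k + n) (sym (ℕ.m∸n+n≡m n≤)) 2i<)
... | no n≰ = trans (cong (λ c → a *ᶻ + c *ᶻ b) (k>n⇒nCk≡0 small)) (trans (cong (_*ᶻ b) (ℤ.*-zeroʳ a)) (ℤ.*-zeroˡ b))
  where
  a = (-1ℤ ^ᶻ (n ∸ i)) *ᶻ ((+ 2) ^ᶻ (2 * i + k ∸ n))
  b = + ((2 * i ∸ n) C k)
  small : i < n ∸ i
  small = ℕ.m+n≤o⇒m≤o∸n (suc i) (subst (_≤ n) (cong (λ j → suc (i + j)) (ℕ.+-identityʳ i)) (ℕ.≰⇒> n≰))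

normal : ℕ → ℕ → ℕ → ℕ → ℕ → ℤ
normal d e i p k = (-1ℤ ^ᶻ d) *ᶻ ((+ 2) ^ᶻ e) *ᶻ (+ (i C d)) *ᶻ (+ (p C k))

term-normal : ∀ n i k {d e p} → n ∸ i ≡ d → 2 * i + k ∸ n ≡ e → 2 * i ∸ n ≡ p → term n i k ≡ normal d e i p k
term-normal n i k refl refl refl = refl

+C-suc : ∀ n k → + (suc n C suc k) ≡ + (n C k) +ᶻ + (n C suc k)
+C-suc n k = trans (cong +_ (sym (nCk+nC[k+1]≡[n+1]C[k+1] n k))) (ℤ.pos-+ (n C k) (n C suc k))

normal-rec : ∀ d p i k → normal (suc d) (suc p + k) (suc i) (suc p) k ≡
  (+ 2) *ᶻ normal (suc d) (p + k) i p k +ᶻ (+ 4) *ᶻ shift 1 (λ k → normal (suc d) (p + k) i p k) k -ᶻ normal d (suc p + k) i (suc p) k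
normal-rec d p i zero = trans
  (cong (λ c → (-1ℤ *ᶻ -1ℤ ^ᶻ d) *ᶻ ((+ 2) *ᶻ (+ 2) ^ᶻ (p + 0)) *ᶻ c *ᶻ 1ℤ) (+C-suc i d))
  (ring (-1ℤ ^ᶻ d) ((+ 2) ^ᶻ (p + 0)) (+ (i C d)) (+ (i C suc d)))
  where
  ring : ∀ s e b a → (-1ℤ *ᶻ s) *ᶻ ((+ 2) *ᶻ e) *ᶻ (b +ᶻ a) *ᶻ 1ℤ ≡
    (+ 2) *ᶻ ((-1ℤ *ᶻ s) *ᶻ e *ᶻ a *ᶻ 1ℤ) +ᶻ (+ 4) *ᶻ 0ℤ -ᶻ s *ᶻ ((+ 2) *ᶻ e) *ᶻ b *ᶻ 1ℤ
  ring = solve-∀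
normal-rec d p i (suc k) rewrite ℕ.+-suc p k = trans
  (cong₂ (λ b c → (-1ℤ *ᶻ -1ℤ ^ᶻ d) *ᶻ ((+ 2) *ᶻ ((+ 2) *ᶻ (+ 2) ^ᶻ (p + k))) *ᶻ b *ᶻ c) (+C-suc i d) (+C-suc p k)) (trans
  (ring (-1ℤ ^ᶻ d) ((+ 2) ^ᶻ (p + k)) (+ (i C d)) (+ (i C suc d)) (+ (p C k)) (+ (p C suc k)))
  (cong (λ c → (+ 2) *ᶻ normal (suc d) (suc (p + k)) i p (suc k) +ᶻ (+ 4) *ᶻ normal (suc d) (p + k) i p k
    -ᶻ (-1ℤ ^ᶻ d) *ᶻ ((+ 2) ^ᶻ (2 + (p + k))) *ᶻ (+ (i C d)) *ᶻ c) (sym (+C-suc p k))))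
  where
  ring : ∀ s e b a c c′ → (-1ℤ *ᶻ s) *ᶻ ((+ 2) *ᶻ ((+ 2) *ᶻ e)) *ᶻ (b +ᶻ a) *ᶻ (c +ᶻ c′) ≡
    (+ 2) *ᶻ ((-1ℤ *ᶻ s) *ᶻ ((+ 2) *ᶻ e) *ᶻ a *ᶻ c′) +ᶻ (+ 4) *ᶻ ((-1ℤ *ᶻ s) *ᶻ e *ᶻ a *ᶻ c) -ᶻ s *ᶻ ((+ 2) *ᶻ ((+ 2) *ᶻ e)) *ᶻ b *ᶻ (c +ᶻ c′)
  ring = solve-∀

∸-cancel : ∀ {a} b {c} → a ≡ b + c → a ∸ b ≡ c
∸-cancel b {c} refl = ℕ.m+n∸m≡n b c

term-rec-zero : ∀ d k → let i = d; n = d + d in term (2 + n) (suc i) k ≡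
  (+ 2) *ᶻ term (1 + n) i k +ᶻ (+ 4) *ᶻ shift 1 (term (1 + n) i) k -ᶻ term n i k
term-rec-zero d k = begin
  term (2 + n) (suc d) k
    ≡⟨ term-normal (2 + n) (suc d) k (∸-cancel (1 + d) (a₁ d)) (∸-cancel (2 + n) (a₂ d k)) (∸-cancel (2 + n) (a₃ d)) ⟩
  normal (suc d) k (suc d) 0 k
    ≡⟨ cong (λ c → (-1ℤ ^ᶻ suc d) *ᶻ ((+ 2) ^ᶻ k) *ᶻ c *ᶻ (+ (0 C k)))
         (trans (+C-suc d d) (cong (λ c → + (d C d) +ᶻ + c) (k>n⇒nCk≡0 (ℕ.n<1+n d)))) ⟩
  (-1ℤ ^ᶻ suc d) *ᶻ ((+ 2) ^ᶻ k) *ᶻ (+ (d C d) +ᶻ 0ℤ) *ᶻ (+ (0 C k))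
    ≡⟨ ring (-1ℤ ^ᶻ d) ((+ 2) ^ᶻ k) (+ (d C d)) (+ (0 C k)) ⟩
  (+ 2) *ᶻ 0ℤ +ᶻ (+ 4) *ᶻ 0ℤ -ᶻ normal d k d 0 k
    ≡⟨ cong₂ _-ᶻ_ (cong₂ (λ a b → (+ 2) *ᶻ a +ᶻ (+ 4) *ᶻ b) (middle k) (trans (shift-cong 1 middle k) (shift-0 1 k)))
         (term-normal n d k (∸-cancel d refl) (∸-cancel n (b₂ d k)) (∸-cancel n (b₃ d))) ⟨
  (+ 2) *ᶻ term (1 + n) d k +ᶻ (+ 4) *ᶻ shift 1 (term (1 + n) d) k -ᶻ term n d k ∎
  where
  open ≡-Reasoning
  n = d + d
  middle : ∀ k → term (1 + n) d k ≡ 0ℤ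
  middle k = term-vanish {1 + n} {d} {k} (bound k)
    where
    bound : ∀ k → 2 * d < k + (1 + n)
    bound k = subst (_≤ k + (1 + n)) (cong (λ j → suc (d + j)) (sym (ℕ.+-identityʳ d))) (ℕ.m≤n+m (1 + n) k)
  a₁ : ∀ d → 2 + (d + d) ≡ 1 + d + suc d
  a₁ = ℕ.solve-∀
  a₂ : ∀ d k → 2 * suc d + k ≡ 2 + (d + d) + k
  a₂ = ℕ.solve-∀
  a₃ : ∀ d → 2 * suc d ≡ 2 + (d + d) + 0
  a₃ = ℕ.solve-∀
  b₂ : ∀ d k → 2 * d + k ≡ d + d + k
  b₂ = ℕ.solve-∀
  b₃ : ∀ d → 2 * d ≡ d + d + 0
  b₃ = ℕ.solve-∀
  ring : ∀ s e b c → (-1ℤ *ᶻ s) *ᶻ e *ᶻ (b +ᶻ 0ℤ) *ᶻ c ≡ (+ 2) *ᶻ 0ℤ +ᶻ (+ 4) *ᶻ 0ℤ -ᶻ s *ᶻ e *ᶻ b *ᶻ c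
  ring = solve-∀

term-rec-suc : ∀ d p k → let i = d + suc p; n = i + d in term (2 + n) (suc i) k ≡
  (+ 2) *ᶻ term (1 + n) i k +ᶻ (+ 4) *ᶻ shift 1 (term (1 + n) i) k -ᶻ term n i k
term-rec-suc d p k = begin
  term (2 + n) (suc i) k
    ≡⟨ term-normal (2 + n) (suc i) k (∸-cancel (1 + i) (a₁ d p)) (∸-cancel (2 + n) (a₂ d p k)) (∸-cancel (2 + n) (a₃ d p)) ⟩
  normal (suc d) (suc p + k) (suc i) (suc p) k
    ≡⟨ normal-rec d p i k ⟩
  (+ 2) *ᶻ normal (suc d) (p + k) i p k +ᶻ (+ 4) *ᶻ shift 1 (λ k → normal (suc d) (p + k) i p k) k -ᶻ normal d (suc p + k) i (suc p) k
    ≡⟨ cong₂ _-ᶻ_ (cong₂ (λ a b → (+ 2) *ᶻ a +ᶻ (+ 4) *ᶻ b) (middle k) (shift-cong 1 middle k)) last ⟨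
  (+ 2) *ᶻ term (1 + n) i k +ᶻ (+ 4) *ᶻ shift 1 (term (1 + n) i) k -ᶻ term n i k ∎
  where
  open ≡-Reasoning
  i = d + suc p
  n = i + d
  a₁ : ∀ d p → 2 + (d + suc p + d) ≡ 1 + (d + suc p) + suc d
  a₁ = ℕ.solve-∀
  a₂ : ∀ d p k → 2 * suc (d + suc p) + k ≡ 2 + (d + suc p + d) + (suc p + k)
  a₂ = ℕ.solve-∀
  a₃ : ∀ d p → 2 * suc (d + suc p) ≡ 2 + (d + suc p + d) + suc p
  a₃ = ℕ.solve-∀
  b₁ : ∀ d p → 1 + (d + suc p + d) ≡ d + suc p + suc d
  b₁ = ℕ.solve-∀
  b₂ : ∀ d p k → 2 * (d + suc p) + k ≡ 1 + (d + suc p + d) + (p + k)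
  b₂ = ℕ.solve-∀
  b₃ : ∀ d p → 2 * (d + suc p) ≡ 1 + (d + suc p + d) + p
  b₃ = ℕ.solve-∀
  c₂ : ∀ d p k → 2 * (d + suc p) + k ≡ d + suc p + d + (suc p + k)
  c₂ = ℕ.solve-∀
  c₃ : ∀ d p → 2 * (d + suc p) ≡ d + suc p + d + suc p
  c₃ = ℕ.solve-∀
  middle : ∀ k → term (1 + n) i k ≡ normal (suc d) (p + k) i p k
  middle k = term-normal (1 + n) i k (∸-cancel i (b₁ d p)) (∸-cancel (1 + n) (b₂ d p k)) (∸-cancel (1 + n) (b₃ d p))
  last : term n i k ≡ normal d (suc p + k) i (suc p) k
  last = term-normal n i k (∸-cancel i refl) (∸-cancel n (c₂ d p k)) (∸-cancel n (c₃ d p))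

term-rec-vanish : ∀ n i k → 2 * i < n → term (2 + n) (suc i) k ≡
  (+ 2) *ᶻ term (1 + n) i k +ᶻ (+ 4) *ᶻ shift 1 (term (1 + n) i) k -ᶻ term n i k
term-rec-vanish n i k 2i<n = trans
  (term-vanish {2 + n} {suc i} {k} (ℕ.≤-trans (subst (_< 2 + n) (sym (ℕ.*-suc 2 i)) (s≤s (s≤s 2i<n))) (ℕ.m≤n+m (2 + n) k)))
  (sym (cong₂ _-ᶻ_ (cong₂ (λ a b → (+ 2) *ᶻ a +ᶻ (+ 4) *ᶻ b) (middle k) (trans (shift-cong 1 middle k) (shift-0 1 k)))
    (term-vanish {n} {i} {k} (ℕ.≤-trans 2i<n (ℕ.m≤n+m n k)))))
  where
  middle : ∀ k → term (1 + n) i k ≡ 0ℤ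
  middle k = term-vanish {1 + n} {i} {k} (ℕ.≤-trans 2i<n (ℕ.≤-trans (ℕ.n≤1+n n) (ℕ.m≤n+m (1 + n) k)))

term-rec : ∀ n i k → i ≤ n → term (2 + n) (suc i) k ≡
  (+ 2) *ᶻ term (1 + n) i k +ᶻ (+ 4) *ᶻ shift 1 (term (1 + n) i) k -ᶻ term n i k
term-rec n i k i≤n with 2 * i <? n
... | yes 2i<n = term-rec-vanish n i k 2i<n
... | no 2i≮n with ℕ.m≤n⇒∃[o]m+o≡n i≤n
...   | d , refl with ℕ.m≤n⇒∃[o]m+o≡n (ℕ.+-cancelˡ-≤ i d i (subst (i + d ≤_) (cong (λ j → i + j) (ℕ.+-identityʳ i)) (ℕ.≮⇒≥ 2i≮n)))
...     | zero  , refl rewrite ℕ.+-identityʳ d = term-rec-zero d k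
...     | suc p , refl = term-rec-suc d p k

-- What term-rec (n - 1) n k should say: the truncated term (n - 1) n k is not zero
-- and has to be dropped.
term-rec-last : ∀ n k → term (1 + n) (1 + n) k ≡ (+ 2) *ᶻ term n n k +ᶻ (+ 4) *ᶻ shift 1 (term n n) k
term-rec-last n k = begin
  term (1 + n) (1 + n) k                            ≡⟨ diagonal (1 + n) k ⟩
  normal 0 (1 + n + k) (1 + n) (1 + n) k            ≡⟨ pascal k ⟩
  (+ 2) *ᶻ normal 0 (n + k) n n k +ᶻ (+ 4) *ᶻ shift 1 (λ k → normal 0 (n + k) n n k) k
    ≡⟨ cong₂ (λ a b → (+ 2) *ᶻ a +ᶻ (+ 4) *ᶻ b) (diagonal n k) (shift-cong 1 (diagonal n) k) ⟨
  (+ 2) *ᶻ term n n k +ᶻ (+ 4) *ᶻ shift 1 (term n n) k ∎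
  where
  open ≡-Reasoning
  a₂ : ∀ n k → 2 * n + k ≡ n + (n + k)
  a₂ = ℕ.solve-∀
  a₃ : ∀ n → 2 * n ≡ n + n
  a₃ = ℕ.solve-∀
  diagonal : ∀ n k → term n n k ≡ normal 0 (n + k) n n k
  diagonal n k = term-normal n n k (ℕ.n∸n≡0 n) (∸-cancel n (a₂ n k)) (∸-cancel n (a₃ n))
  ring₀ : ∀ e → 1ℤ *ᶻ ((+ 2) *ᶻ e) *ᶻ 1ℤ *ᶻ 1ℤ ≡ (+ 2) *ᶻ (1ℤ *ᶻ e *ᶻ 1ℤ *ᶻ 1ℤ) +ᶻ (+ 4) *ᶻ 0ℤ
  ring₀ = solve-∀
  ring : ∀ e c c′ → 1ℤ *ᶻ ((+ 2) *ᶻ ((+ 2) *ᶻ e)) *ᶻ 1ℤ *ᶻ (c +ᶻ c′) ≡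
    (+ 2) *ᶻ (1ℤ *ᶻ ((+ 2) *ᶻ e) *ᶻ 1ℤ *ᶻ c′) +ᶻ (+ 4) *ᶻ (1ℤ *ᶻ e *ᶻ 1ℤ *ᶻ c)
  ring = solve-∀
  pascal : ∀ k → normal 0 (1 + n + k) (1 + n) (1 + n) k ≡
    (+ 2) *ᶻ normal 0 (n + k) n n k +ᶻ (+ 4) *ᶻ shift 1 (λ k → normal 0 (n + k) n n k) k
  pascal zero = ring₀ ((+ 2) ^ᶻ (n + 0))
  pascal (suc k) rewrite ℕ.+-suc n k = trans
    (cong (λ c → 1ℤ *ᶻ ((+ 2) *ᶻ ((+ 2) *ᶻ (+ 2) ^ᶻ (n + k))) *ᶻ 1ℤ *ᶻ c) (+C-suc n k))
    (ring ((+ 2) ^ᶻ (n + k)) (+ (n C k)) (+ (n C suc k)))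

total-rec : ∀ n k → total (2 + n) k ≡ (+ 2) *ᶻ total (1 + n) k +ᶻ (+ 4) *ᶻ shift 1 (total (1 + n)) k -ᶻ total n k
total-rec n k = begin
  total (2 + n) k
    ≡⟨ cong (_+ᶻ sumTo (2 + n) next) (term-vanish {2 + n} {0} {k} (ℕ.≤-trans (s≤s z≤n) (ℕ.m≤n+m (2 + n) k))) ⟩
  0ℤ +ᶻ sumTo (2 + n) next
    ≡⟨ trans (ℤ.+-identityˡ _) (sumTo-last (1 + n) next) ⟩
  sumTo (1 + n) next +ᶻ next (1 + n)
    ≡⟨ cong₂ _+ᶻ_ (trans (sumTo-cong (1 + n) λ { i (s≤s i≤n) → term-rec n i k i≤n })
         (sumTo-combine (1 + n) same lower (λ i → term n i k))) (term-rec-last (1 + n) k) ⟩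
  ((+ 2) *ᶻ sumTo (1 + n) same +ᶻ (+ 4) *ᶻ sumTo (1 + n) lower -ᶻ total n k)
    +ᶻ ((+ 2) *ᶻ same (1 + n) +ᶻ (+ 4) *ᶻ lower (1 + n))
    ≡⟨ ring (sumTo (1 + n) same) (sumTo (1 + n) lower) (total n k) (same (1 + n)) (lower (1 + n)) ⟩
  (+ 2) *ᶻ (sumTo (1 + n) same +ᶻ same (1 + n)) +ᶻ (+ 4) *ᶻ (sumTo (1 + n) lower +ᶻ lower (1 + n)) -ᶻ total n k
    ≡⟨ cong₂ (λ a b → (+ 2) *ᶻ a +ᶻ (+ 4) *ᶻ b -ᶻ total n k)
         (sumTo-last (1 + n) same) (trans (shift-sum k) (sumTo-last (1 + n) lower)) ⟨
  (+ 2) *ᶻ total (1 + n) k +ᶻ (+ 4) *ᶻ shift 1 (total (1 + n)) k -ᶻ total n k ∎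
  where
  open ≡-Reasoning
  next same lower : ℕ → ℤ
  next  i = term (2 + n) (suc i) k
  same  i = term (1 + n) i k
  lower i = shift 1 (term (1 + n) i) k
  ring : ∀ a b t c d → ((+ 2) *ᶻ a +ᶻ (+ 4) *ᶻ b -ᶻ t) +ᶻ ((+ 2) *ᶻ c +ᶻ (+ 4) *ᶻ d) ≡
    (+ 2) *ᶻ (a +ᶻ c) +ᶻ (+ 4) *ᶻ (b +ᶻ d) -ᶻ t
  ring = solve-∀
  shift-sum : ∀ k → shift 1 (total (1 + n)) k ≡ sumTo (2 + n) (λ i → shift 1 (term (1 + n) i) k)
  shift-sum zero    = sym (sumTo-0 (2 + n) λ _ _ → refl)
  shift-sum (suc k) = refl

<⌈/2⌉⇒2*< : ∀ i m → i < ⌈ m /2⌉ → 2 * i < m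
<⌈/2⌉⇒2*< zero    (suc m)       _         = s≤s z≤n
<⌈/2⌉⇒2*< (suc i) (suc (suc m)) (s≤s i<) = subst (_< 2 + m) (sym (ℕ.*-suc 2 i)) (s≤s (s≤s (<⌈/2⌉⇒2*< i m i<)))
<⌈/2⌉⇒2*< (suc i) (suc zero)    (s≤s ())

closedForm : ℕ → Poly
closedForm n = ∑[ 0 ⋯ n ] (λ j → ∑[ ⌈ j + n /2⌉ ⋯ n ] (λ i → term n i j ·ₚ x^ j))

coeff-closedForm : ∀ n k → coeff (closedForm n) k ≡ total n k
coeff-closedForm n k = trans (trans (coeff-sum (suc n) column k) (sumTo-cong (suc n) λ j _ → column-sum j)) row-sum
  where
  open ≡-Reasoning
  column : ℕ → Poly
  column j = ∑[ ⌈ j + n /2⌉ ⋯ n ] (λ i → term n i j ·ₚ x^ j)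
  partial : ℕ → ℤ
  partial j = sumTo (suc n ∸ ⌈ j + n /2⌉) (λ t → term n (⌈ j + n /2⌉ + t) j)
  column-sum : ∀ j → coeff (column j) k ≡ partial j *ᶻ coeff (x^ j) k
  column-sum j = trans (coeff-sum (suc n ∸ ⌈ j + n /2⌉) _ k) (trans
    (sumTo-cong (suc n ∸ ⌈ j + n /2⌉) λ t _ → coeff-·ₚ (term n (⌈ j + n /2⌉ + t) j) (x^ j) k)
    (sumTo-*ʳ (suc n ∸ ⌈ j + n /2⌉) _ (coeff (x^ j) k)))
  row-sum : sumTo (suc n) (λ j → partial j *ᶻ coeff (x^ j) k) ≡ total n k
  row-sum with k ≤? n
  ... | no k≰n = trans (sumTo-x^-≥ partial (ℕ.≰⇒> k≰n)) (sym (sumTo-0 (suc n) λ { i (s≤s i≤n) →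
    term-vanish {n} {i} {k} (ℕ.+-mono-<-≤ (ℕ.≤-<-trans i≤n (ℕ.≰⇒> k≰n)) (subst (_≤ n) (sym (ℕ.+-identityʳ i)) i≤n)) }))
  ... | yes k≤n = begin
    sumTo (suc n) (λ j → partial j *ᶻ coeff (x^ j) k)
      ≡⟨ sumTo-x^-< partial (s≤s k≤n) ⟩
    partial k
      ≡⟨ ℤ.+-identityˡ _ ⟨
    0ℤ +ᶻ partial k
      ≡⟨ cong (_+ᶻ partial k) (sumTo-0 a λ i i<a → term-vanish {n} {i} {k} (<⌈/2⌉⇒2*< i (k + n) i<a)) ⟨
    sumTo a (λ i → term n i k) +ᶻ partial k
      ≡⟨ sumTo-split a (suc n ∸ a) _ ⟨
    sumTo (a + (suc n ∸ a)) (λ i → term n i k)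
      ≡⟨ cong (λ N → sumTo N (λ i → term n i k)) (ℕ.m+[n∸m]≡n a≤) ⟩
    total n k ∎
    where
    a = ⌈ k + n /2⌉
    a≤ : a ≤ suc n
    a≤ = ℕ.≤-trans (ℕ.⌈n/2⌉-mono (ℕ.+-monoˡ-≤ n k≤n)) (ℕ.≤-trans (ℕ.≤-reflexive (sym (ℕ.n≡⌈n+n/2⌉ n))) (ℕ.n≤1+n n))

private variable
  n : ℕ

-- Matchings as words

data Side : Set where
  top bot : Side

data Half : Set where
  left right : Half

data Pos : Set where
  outer inner : Half → Pos

-- The vertices of H_n.  The fragments are bounded by n + 1 vertical edges bnd k, whose
-- ends are the bd k s.  The other vertices of a fragment form a 3 × 4 grid: in each
-- half (top or bot), ctr and the two inn lie in the middle row, apex and the two tip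
-- in the outer row.
data Node (n : ℕ) : Set where
  bd        : Fin (suc n) → Side → Node n
  inn tip   : Side → Fin n → Half → Node n
  ctr apex  : Side → Fin n → Node n

-- The edges of H_n: hor in the middle rows, cap in the outer rows, rung from a middle
-- to an outer row, mid and bnd between the two middle rows.
data Bond (n : ℕ) : Set where
  hor      : Side → Fin n → Pos → Bond n
  cap rung : Side → Fin n → Half → Bond n
  mid      : Fin n → Bond n
  bnd      : Fin (suc n) → Bond n

border : Half → Fin n → Fin (suc n)
border left  = inject₁
border right = suc

data Inc {n : ℕ} : Node n → Bond n → Set where
  bdO   : ∀ {k s j h} → border h j ≡ k → Inc (bd k s) (hor s j (outer h))
  bdB   : ∀ {k s} → Inc (bd k s) (bnd k)
  innO  : ∀ {s i h} → Inc (inn s i h) (hor s i (outer h))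
  innI  : ∀ {s i h} → Inc (inn s i h) (hor s i (inner h))
  innR  : ∀ {s i h} → Inc (inn s i h) (rung s i h)
  ctrI  : ∀ {s i h} → Inc (ctr s i) (hor s i (inner h))
  ctrM  : ∀ {s i} → Inc (ctr s i) (mid i)
  tipC  : ∀ {s i h} → Inc (tip s i h) (cap s i h)
  tipR  : ∀ {s i h} → Inc (tip s i h) (rung s i h)
  apexC : ∀ {s i h} → Inc (apex s i) (cap s i h)

record ExactCover (X : Bond n → Set) : Set where
  field
    covers : ∀ u → ∃ λ x → X x × Inc u x
    unique : ∀ {u x y} → X x → X y → Inc u x → Inc u y → x ≡ y

half : Pos → Half
half (outer h) = h
half (inner h) = h

other : Half → Half
other left  = right
other right = left

other≢ : ∀ h → other h ≢ h
other≢ left  ()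
other≢ right ()

≢⇒other : ∀ {h h′} → h ≢ h′ → other h ≡ h′
≢⇒other {left}  {left}  h≢ = contradiction refl h≢
≢⇒other {left}  {right} _  = refl
≢⇒other {right} {left}  _  = refl
≢⇒other {right} {right} h≢ = contradiction refl h≢

_≟ʰ_ : (h h′ : Half) → Dec (h ≡ h′)
left  ≟ʰ left  = yes refl
left  ≟ʰ right = no λ ()
right ≟ʰ left  = no λ ()
right ≟ʰ right = yes refl

_≟ᵖ_ : (p p′ : Pos) → Dec (p ≡ p′)
outer h ≟ᵖ outer h′ = map′ (cong outer) (cong half) (h ≟ʰ h′)
outer _ ≟ᵖ inner _  = no λ ()
inner _ ≟ᵖ outer _  = no λ ()
inner h ≟ᵖ inner h′ = map′ (cong inner) (cong half) (h ≟ʰ h′)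

data Letter : Set where
  end : Half → Letter
  mid : Half → Half → Letter

pos : Letter → Side → Pos
pos (end h)   _   = outer h
pos (mid a _) top = inner a
pos (mid _ b) bot = inner b

pos-end : ∀ {l s h} → pos l s ≡ outer h → l ≡ end h
pos-end {end _}         refl = refl
pos-end {mid _ _} {top} ()
pos-end {mid _ _} {bot} ()

pos-injective : ∀ {l l′} → (∀ s → pos l s ≡ pos l′ s) → l ≡ l′
pos-injective {end _}   {l′}      eq = sym (pos-end {l′} (sym (eq top)))
pos-injective {mid _ _} {end _}   eq = contradiction (eq top) λ ()
pos-injective {mid _ _} {mid _ _} eq = cong₂ mid (cong half (eq top)) (cong half (eq bot))

data IsEnd : Letter → Set where
  isEnd : ∀ {h} → IsEnd (end h)

Word : ℕ → Set
Word = Vec Letter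

Taken : Word n → Fin (suc n) → Set
Taken w k = ∃ λ j → ∃ λ h → border h j ≡ k × lookup w j ≡ end h

On : Word n → Bond n → Set
On w (hor s i p)  = pos (lookup w i) s ≡ p
On w (cap s i h)  = half (pos (lookup w i) s) ≡ h
On w (rung s i h) = half (pos (lookup w i) s) ≢ h
On w (mid i)      = IsEnd (lookup w i)
On w (bnd k)      = ¬ Taken w k

isEnd? : ∀ l → Dec (IsEnd l)
isEnd? (end _)   = yes isEnd
isEnd? (mid _ _) = no λ ()

anyHalf? : {P : Half → Set} → (∀ h → Dec (P h)) → Dec (∃ P)
anyHalf? P? = map′ [ (left ,_) , (right ,_) ]′ (λ { (left , p) → inj₁ p ; (right , p) → inj₂ p }) (P? left ⊎-dec P? right)

_≟end_ : ∀ l h → Dec (l ≡ end h)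
l ≟end h = map′ pos-end (cong (λ l → pos l top)) (pos l top ≟ᵖ outer h)

taken? : ∀ (w : Word n) k → Dec (Taken w k)
taken? w k = Fin.any? λ j → anyHalf? λ h → (border h j Fin.≟ k) ×-dec (lookup w j ≟end h)

on? : ∀ (w : Word n) x → Dec (On w x)
on? w (hor s i p)  = pos (lookup w i) s ≟ᵖ p
on? w (cap s i h)  = half (pos (lookup w i) s) ≟ʰ h
on? w (rung s i h) = ¬? (half (pos (lookup w i) s) ≟ʰ h)
on? w (mid i)      = isEnd? (lookup w i)
on? w (bnd k)      = ¬? (taken? w k)

Valid : Word n → Set
Valid w = ∀ i j → suc i ≡ inject₁ j → lookup w i ≡ end right → lookup w j ≢ end left

on-exactCover : {w : Word n} → Valid w → ExactCover (On w)
on-exactCover {n} {w} valid = record { covers = covers ; unique = unique }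
  where
  covers : ∀ u → ∃ λ x → On w x × Inc u x
  covers (bd k s) with taken? w k
  ... | yes (j , h , eq , l) = hor s j (outer h) , cong (λ l → pos l s) l , bdO eq
  ... | no ¬t                = bnd k , ¬t , bdB
  covers (inn s i h) with pos (lookup w i) s ≟ᵖ outer h | pos (lookup w i) s ≟ᵖ inner h
  ... | yes eq | _      = hor s i (outer h) , eq , innO
  ... | no _   | yes eq = hor s i (inner h) , eq , innI
  ... | no ¬o  | no ¬i  = rung s i h , ¬half (pos (lookup w i) s) ¬o ¬i , innR
    where
    ¬half : ∀ p → p ≢ outer h → p ≢ inner h → half p ≢ h
    ¬half (outer _) ¬o _ refl = ¬o refl
    ¬half (inner _) _ ¬i refl = ¬i refl
  covers (ctr s i) with pos (lookup w i) s in eq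
  ... | outer h = mid i , subst IsEnd (sym (pos-end {lookup w i} eq)) isEnd , ctrM
  ... | inner h = hor s i (inner h) , eq , ctrI
  covers (tip s i h) with half (pos (lookup w i) s) ≟ʰ h
  ... | yes eq = cap s i h , eq , tipC
  ... | no h≢  = rung s i h , h≢ , tipR
  covers (apex s i) = cap s i _ , refl , apexC

  border-unique : ∀ {i j h h′} → border h i ≡ border h′ j → lookup w i ≡ end h → lookup w j ≡ end h′ →
    (i , h) ≡ (j , h′)
  border-unique {h = left}  {left}  eq _ _ = cong (_, left) (Fin.inject₁-injective eq)
  border-unique {h = left}  {right} eq p q = contradiction p (valid _ _ (sym eq) q)
  border-unique {h = right} {left}  eq p q = contradiction q (valid _ _ eq p)
  border-unique {h = right} {right} eq _ _ = cong (_, right) (Fin.suc-injective eq)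

  end≢inner : ∀ {l h s} → IsEnd l → pos l s ≢ inner h
  end≢inner isEnd ()

  unique : ∀ {u x y} → On w x → On w y → Inc u x → Inc u y → x ≡ y
  unique p q (bdO {s = s} eq) (bdO eq′) =
    cong (λ (j , h) → hor s j (outer h)) (border-unique (trans eq (sym eq′)) (pos-end p) (pos-end q))
  unique p ¬t (bdO eq) bdB = contradiction (_ , _ , eq , pos-end p) ¬t
  unique ¬t q bdB (bdO eq) = contradiction (_ , _ , eq , pos-end q) ¬t
  unique _ _ bdB bdB = refl
  unique _ _ innO innO = refl
  unique p q innO innI = contradiction (trans (sym p) q) λ ()
  unique p q innO innR = contradiction (cong half p) q
  unique p q innI innO = contradiction (trans (sym p) q) λ ()
  unique _ _ innI innI = refl
  unique p q innI innR = contradiction (cong half p) q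
  unique p q innR innO = contradiction (cong half q) p
  unique p q innR innI = contradiction (cong half q) p
  unique _ _ innR innR = refl
  unique p q (ctrI {s} {i}) ctrI = cong (hor s i) (trans (sym p) q)
  unique p q ctrI ctrM = contradiction p (end≢inner q)
  unique p q ctrM ctrI = contradiction q (end≢inner p)
  unique _ _ ctrM ctrM = refl
  unique _ _ tipC tipC = refl
  unique p q tipC tipR = contradiction p q
  unique p q tipR tipC = contradiction q p
  unique _ _ tipR tipR = refl
  unique p q (apexC {s} {i}) apexC = cong (cap s i) (trans (sym p) q)

module _ {X : Bond n → Set} (cover : ExactCover X) where
  open ExactCover cover

  private
    cap-injective : ∀ {s i h h′} → cap {n} s i h ≡ cap s i h′ → h ≡ h′
    cap-injective refl = refl

    hor-injective : ∀ {s i p p′} → hor {n} s i p ≡ hor s i p′ → p ≡ p′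
    hor-injective refl = refl

    side : ∀ s i → ∃ λ p → X (hor s i p) × X (cap s i (half p)) × X (rung s i (other (half p)))
    side s i with covers (apex s i)
    ... | _ , c , apexC {h = h} with covers (tip s i (other h))
    ...   | _ , c′ , tipC with () ← other≢ h (cap-injective (unique c′ c apexC apexC))
    ...   | _ , r , tipR with covers (inn s i h)
    ...     | _ , o , innO = outer h , o , c , r
    ...     | _ , o , innI = inner h , o , c , r
    ...     | _ , r′ , innR with () ← unique c r′ tipC tipR

    inc-inn : ∀ {s i} p → Inc {n} (inn s i (half p)) (hor s i p)
    inc-inn (outer _) = innO
    inc-inn (inner _) = innI

    no-rung : ∀ {s i p} → X (hor s i p) → ¬ X (rung s i (half p))
    no-rung {p = p} x r with () ← unique x r (inc-inn p) innR

    hor-unique : ∀ {s i p p′} → X (hor s i p) → X (hor s i p′) → p ≡ p′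
    hor-unique {s} {i} x x′ = trans (main x) (sym (main x′))
      where
      main : ∀ {p} → X (hor s i p) → p ≡ proj₁ (side s i)
      main {p} x with side s i
      ... | q , y , _ , r with half q ≟ʰ half p
      ...   | yes eq = hor-injective (unique x y (inc-inn p) (subst (λ h → Inc (inn s i h) (hor s i q)) eq (inc-inn q)))
      ...   | no h≢  = contradiction (subst (λ h → X (rung s i h)) (≢⇒other h≢) r) (no-rung x)

    hor-cap : ∀ {s i p} → X (hor s i p) → X (cap s i (half p))
    hor-cap {s} {i} x with side s i
    ... | q , y , c , _ rewrite hor-unique x y = c

    hor-rung : ∀ {s i p} → X (hor s i p) → X (rung s i (other (half p)))
    hor-rung {s} {i} x with side s i
    ... | q , y , _ , r rewrite hor-unique x y = r

    outer-mid : ∀ {s i h} → X (hor s i (outer h)) → X (mid i)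
    outer-mid {s} {i} x with covers (ctr s i)
    ... | _ , m , ctrM = m
    ... | _ , y , ctrI with () ← hor-unique x y

    mid-outer : ∀ {i} s → X (mid i) → ∃ λ h → X (hor s i (outer h))
    mid-outer {i} s m with side s i
    ... | outer h , x , _ = h , x
    ... | inner h , x , _ with () ← unique x m ctrI ctrM

    -- The horizontal edges at a border agree in the two rows, as the vertical
    -- edge of the border covers both ends or none; this propagates to the right.
    sync-right : ∀ k s s′ j → suc j ≡ k → X (hor s j (outer right)) → X (hor s′ j (outer right))
    sync-left  : ∀ j → (∀ s s′ i → suc i ≡ inject₁ j → X (hor s i (outer right)) → X (hor s′ i (outer right))) →
      ∀ s s′ → X (hor s j (outer left)) → X (hor s′ j (outer left))
    sync-left j ih s s′ x with covers (bd (inject₁ j) s′)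
    ... | _ , b , bdB with () ← unique {bd (inject₁ j) s} x b (bdO refl) bdB
    ... | _ , y , bdO {h = left} eq with refl ← Fin.inject₁-injective eq = y
    ... | _ , y , bdO {h = right} eq
      with () ← unique {bd (inject₁ j) s} x (ih s′ s _ eq y) (bdO refl) (bdO eq)
    sync-right = <-weakInduction _ (λ _ _ _ ()) step
      where
      step : ∀ i → (∀ s s′ j → suc j ≡ inject₁ i → X (hor s j (outer right)) → X (hor s′ j (outer right))) →
        ∀ s s′ j → suc j ≡ suc i → X (hor s j (outer right)) → X (hor s′ j (outer right))
      step i ih s s′ .i refl x with mid-outer s′ (outer-mid x)
      ... | right , y = y
      ... | left  , y with () ← hor-unique x (sync-left i ih s′ s y)

    sync : ∀ h s s′ i → X (hor s i (outer h)) → X (hor s′ i (outer h))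
    sync left  s s′ i = sync-left i (sync-right (inject₁ i)) s s′
    sync right s s′ i = sync-right (suc i) s s′ i refl

    letter : ∀ i → ∃ λ l → ∀ s → X (hor s i (pos l s))
    letter i with side top i | side bot i
    ... | outer h , x , _ | _               = end h , λ s → sync h top s i x
    ... | inner a , x , _ | inner b , y , _ = mid a b , λ { top → x ; bot → y }
    ... | inner a , x , _ | outer h , y , _ with () ← hor-unique x (sync h bot top i y)

  word : Word n
  word = tabulate (proj₁ ∘ letter)

  private
    word-hor : ∀ s i → X (hor s i (pos (lookup word i) s))
    word-hor s i rewrite Vec.lookup∘tabulate (proj₁ ∘ letter) i = proj₂ (letter i) s

    word-outer : ∀ {s i h} → lookup word i ≡ end h → X (hor s i (outer h))
    word-outer {s} {i} eq = subst (λ l → X (hor s i (pos l s))) eq (word-hor s i)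

  word-valid : Valid word
  word-valid i j eq p q with () ← unique {bd (suc i) top} (word-outer p) (word-outer q) (bdO refl) (bdO (sym eq))

  on⇒ : ∀ x → On word x → X x
  on⇒ (hor s i p)  refl = word-hor s i
  on⇒ (cap s i h)  refl = hor-cap (word-hor s i)
  on⇒ (rung s i h) h≢   = subst (λ h → X (rung s i h)) (≢⇒other h≢) (hor-rung (word-hor s i))
  on⇒ (mid i)      e    with lookup word i in eq
  on⇒ (mid i)      isEnd | end h = outer-mid {top} (word-outer eq)
  on⇒ (bnd k)      ¬t   with covers (bd k top)
  ... | _ , b , bdB            = b
  ... | _ , x , bdO {j = j} eq = contradiction (_ , _ , eq , pos-end (hor-unique (word-hor top j) x)) ¬t

  ⇒on : ∀ x → X x → On word x
  ⇒on (hor s i p)  x = hor-unique (word-hor s i) x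
  ⇒on (cap s i h)  x with refl ← unique x (hor-cap (word-hor s i)) apexC apexC = refl
  ⇒on (rung s i h) x refl = no-rung (word-hor s i) x
  ⇒on (mid i)      x with mid-outer top x
  ... | h , y = subst IsEnd (sym (pos-end (hor-unique (word-hor top i) y))) isEnd
  ⇒on (bnd k)      x (j , h , eq , l) with () ← unique {bd k top} x (word-outer l) bdB (bdO eq)

midLetters : List Letter
midLetters = mid left left ∷ mid left right ∷ mid right left ∷ mid right right ∷ []

∈-midLetters : ∀ a b → mid a b ∈ₗ midLetters
∈-midLetters left  left  = here refl
∈-midLetters left  right = there (here refl)
∈-midLetters right left  = there (there (here refl))
∈-midLetters right right = there (there (there (here refl)))

midLetters-mid : All (λ l → ∀ h → l ≢ end h) midLetters
midLetters-mid = (λ _ ()) ∷ (λ _ ()) ∷ (λ _ ()) ∷ (λ _ ()) ∷ []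

midLetters-unique : Unique midLetters
midLetters-unique = ((λ ()) ∷ (λ ()) ∷ (λ ()) ∷ []) ∷ ((λ ()) ∷ (λ ()) ∷ []) ∷ ((λ ()) ∷ []) ∷ [] ∷ []

words nonLeftWords : ∀ n → List (Word n)
words zero    = [] ∷ []
words (suc n) = map (end left ∷_) (words n) ++ nonLeftWords (suc n)
nonLeftWords zero    = [] ∷ []
nonLeftWords (suc n) = cartesianProductWith _∷_ midLetters (words n) ++ map (end right ∷_) (nonLeftWords n)

NonLeft : Word n → Set
NonLeft w = ∀ j → inject₁ j ≡ zero → lookup w j ≢ end left

valid-∷ : ∀ {l} {w : Word n} → Valid w → (l ≡ end right → NonLeft w) → Valid (l ∷ w)
valid-∷ v nl zero    (suc j) eq p = nl p j (sym (Fin.suc-injective eq))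
valid-∷ v nl (suc i) (suc j) eq   = v i j (Fin.suc-injective eq)

valid-tail : ∀ {l} {w : Word n} → Valid (l ∷ w) → Valid w
valid-tail v i j eq = v (suc i) (suc j) (cong suc eq)

valid-nonLeft : {w : Word n} → Valid (end right ∷ w) → NonLeft w
valid-nonLeft v j eq = v zero (suc j) (cong suc (sym eq)) refl

∈-words     : (w : Word n) → Valid w → w ∈ₗ words n
∈-nonLeft   : (w : Word n) → Valid w → NonLeft w → w ∈ₗ nonLeftWords n
∈-words     []                _ = here refl
∈-words     (end left ∷ w)    v = ∈-++⁺ˡ (∈-map⁺ _ (∈-words w (valid-tail v)))
∈-words {suc n} (end right ∷ w)   v = ∈-++⁺ʳ (map (end left ∷_) (words n)) (∈-nonLeft (end right ∷ w) v λ { zero _ () ; (suc _) () })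
∈-words {suc n} (mid a b ∷ w)     v = ∈-++⁺ʳ (map (end left ∷_) (words n)) (∈-nonLeft (mid a b ∷ w) v λ { zero _ () ; (suc _) () })
∈-nonLeft   []                _ _  = here refl
∈-nonLeft   (end left ∷ w)    _ nl = contradiction refl (nl zero refl)
∈-nonLeft {suc n} (end right ∷ w)   v _  =
  ∈-++⁺ʳ (cartesianProductWith _∷_ midLetters (words n)) (∈-map⁺ _ (∈-nonLeft w (valid-tail v) (valid-nonLeft v)))
∈-nonLeft   (mid a b ∷ w)     v _  = ∈-++⁺ˡ (∈-cartesianProductWith⁺ _∷_ (∈-midLetters a b) (∈-words w (valid-tail v)))

words-valid    : ∀ n {w : Word n} → w ∈ₗ words n → Valid w
nonLeft-valid : ∀ n {w : Word n} → w ∈ₗ nonLeftWords n → Valid w × NonLeft w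
words-valid zero    (here refl) ()
words-valid (suc n) w∈ with ∈-++⁻ (map (end left ∷_) (words n)) w∈
... | inj₂ w∈′ = proj₁ (nonLeft-valid (suc n) w∈′)
... | inj₁ w∈′ with ∈-map⁻ _ w∈′
...   | _ , v∈ , refl = valid-∷ (words-valid n v∈) λ ()
nonLeft-valid zero    (here refl) = (λ ()) , λ ()
nonLeft-valid (suc n) w∈ with ∈-++⁻ (cartesianProductWith _∷_ midLetters (words n)) w∈
... | inj₁ w∈′ with ∈-cartesianProductWith⁻ _∷_ midLetters (words n) w∈′
...   | _ , _ , l∈ , v∈ , refl =
  valid-∷ (words-valid n v∈) (λ eq → contradiction eq (All.lookup midLetters-mid l∈ right))
  , λ { zero _ eq → All.lookup midLetters-mid l∈ left eq ; (suc _) () }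
nonLeft-valid (suc n) w∈ | inj₂ w∈′ with ∈-map⁻ _ w∈′
...   | _ , v∈ , refl =
  let v , nl = nonLeft-valid n v∈ in valid-∷ v (λ _ → nl) , λ { zero _ () ; (suc _) () }

words-unique   : ∀ n → Unique (words n)
nonLeft-unique : ∀ n → Unique (nonLeftWords n)
words-unique zero    = [] ∷ []
words-unique (suc n) = Unique.++⁺ (Unique.map⁺ Vec.∷-injectiveʳ (words-unique n)) (nonLeft-unique (suc n))
  λ (p , q) → case ∈-map⁻ _ p of λ { (_ , _ , refl) → proj₂ (nonLeft-valid (suc n) q) zero refl refl }
nonLeft-unique zero    = [] ∷ []
nonLeft-unique (suc n) = Unique.++⁺
  (Unique.cartesianProductWith⁺ _∷_ Vec.∷-injective midLetters-unique (words-unique n))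
  (Unique.map⁺ Vec.∷-injectiveʳ (nonLeft-unique n))
  λ (p , q) → case ∈-map⁻ _ q of λ { (_ , _ , refl) →
    case ∈-cartesianProductWith⁻ _∷_ midLetters (words n) p of λ { (_ , _ , l∈ , _ , eq) →
      All.lookup midLetters-mid l∈ right (sym (Vec.∷-injectiveˡ eq)) } }

mids : Word n → ℕ
mids []            = 0
mids (end _ ∷ w)   = mids w
mids (mid _ _ ∷ w) = suc (mids w)

sides : Letter → List Side
sides (end _)   = top ∷ []
sides (mid _ _) = top ∷ bot ∷ []

canon : Letter → Side → Side
canon (end _)   _ = top
canon (mid _ _) s = s

rep : Word n → Fin n → Side → Bond n
rep w i s = hor s i (pos (lookup w i) s)

reps : Word n → Fin n → List (Bond n)
reps w i = map (rep w i) (sides (lookup w i))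

req : Word n → List (Bond n)
req w = concat (List.tabulate (reps w))

-- Classes of edges, each represented by an edge of req w: an exchange of w only removes
-- edges of a single class.
key : Word n → Bond n → Bond n
key w (hor s i _)  = rep w i (canon (lookup w i) s)
key w (cap s i _)  = rep w i (canon (lookup w i) s)
key w (rung s i _) = rep w i (canon (lookup w i) s)
key w (mid i)      = rep w i top
key w (bnd k)      = bnd k

∈-req⁻ : ∀ (w : Word n) {x} → x ∈ₗ req w → ∃ λ i → ∃ λ s → s ∈ₗ sides (lookup w i) × x ≡ rep w i s
∈-req⁻ w x∈ with ∈-concat⁻′ (List.tabulate (reps w)) x∈
... | _ , x∈xs , xs∈ with ∈-tabulate⁻ {f = reps w} xs∈
...   | i , refl with ∈-map⁻ (rep w i) x∈xs
...     | s , s∈ , eq = i , s , s∈ , eq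

∈-req⁺ : ∀ (w : Word n) i {s} → s ∈ₗ sides (lookup w i) → rep w i s ∈ₗ req w
∈-req⁺ w i s∈ = ∈-concat⁺′ (∈-map⁺ (rep w i) s∈) (∈-tabulate⁺ i)

req-unique : ∀ (w : Word n) → Unique (req w)
req-unique w = Unique.concat⁺ (All.tabulate⁺ reps-unique) (AllPairs.tabulate⁺ disjoint)
  where
  reps-unique : ∀ i → Unique (reps w i)
  reps-unique i = Unique.map⁺ (λ { refl → refl }) (sides-unique (lookup w i))
    where
    sides-unique : ∀ l → Unique (sides l)
    sides-unique (end _)   = [] ∷ []
    sides-unique (mid _ _) = ((λ ()) ∷ []) ∷ [] ∷ []
  disjoint : ∀ {i j} → i ≢ j → ∀ {x} → ¬ (x ∈ₗ reps w i × x ∈ₗ reps w j)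
  disjoint {i} {j} i≢j (p , q) with ∈-map⁻ (rep w i) p | ∈-map⁻ (rep w j) q
  ... | _ , _ , refl | _ , _ , refl = i≢j refl

length-req : (w : Word n) → length (req w) ≡ n + mids w
length-req w = go w λ i → List.length-map (rep w i) (sides (lookup w i))
  where
  go : ∀ {A : Set} {m} (w : Word m) {f : Fin m → List A} → (∀ i → length (f i) ≡ length (sides (lookup w i))) →
    length (concat (List.tabulate f)) ≡ m + mids w
  go []              _  = refl
  go {m = suc m} (l ∷ w) {f} eq
    rewrite List.length-++ (f zero) {concat (List.tabulate (f ∘ suc))} | eq zero | go w {f ∘ suc} (eq ∘ suc) with l
  ... | end _   = refl
  ... | mid _ _ = cong suc (sym (ℕ.+-suc m (mids w)))

req-forces : ∀ (w w′ : Word n) → (∀ {x} → x ∈ₗ req w → On w′ x) → w′ ≡ w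
req-forces w w′ on = trans (sym (Vec.tabulate∘lookup w′)) (trans (Vec.tabulate-cong same) (Vec.tabulate∘lookup w))
  where
  letter : ∀ l l′ → (∀ {s} → s ∈ₗ sides l → pos l′ s ≡ pos l s) → l′ ≡ l
  letter (end h)   l′ eq = pos-end (eq (here refl))
  letter (mid _ _) l′ eq = pos-injective λ { top → eq (here refl) ; bot → eq (there (here refl)) }
  same : ∀ i → lookup w′ i ≡ lookup w i
  same i = letter _ _ λ s∈ → on (∈-req⁺ w i s∈)

switch : Letter → Side → Letter
switch (end h)   _   = mid h h
switch (mid a b) top = mid (other a) b
switch (mid a b) bot = mid a (other b)

switch-mid : ∀ l s h → switch l s ≢ end h
switch-mid (end _)   _   _ ()
switch-mid (mid _ _) top _ ()
switch-mid (mid _ _) bot _ ()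

switch-pos : ∀ l s → pos (switch l s) s ≢ pos l s
switch-pos (end _)   top ()
switch-pos (end _)   bot ()
switch-pos (mid a _) top eq = other≢ a (cong half eq)
switch-pos (mid _ b) bot eq = other≢ b (cong half eq)

switch-local : ∀ l {s} s′ → s ∈ₗ sides l → canon l s′ ≡ s ⊎ pos l s′ ≡ pos (switch l s) s′
switch-local (end _)   _   (here refl)         = inj₁ refl
switch-local (mid _ _) top (here refl)         = inj₁ refl
switch-local (mid _ _) bot (here refl)         = inj₂ refl
switch-local (mid _ _) top (there (here refl)) = inj₂ refl
switch-local (mid _ _) bot (there (here refl)) = inj₁ refl

module _ (w : Word n) (i : Fin n) {s : Side} (s∈ : s ∈ₗ sides (lookup w i)) where

  switched : Word n
  switched = w [ i ]≔ switch (lookup w i) s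

  private
    at-i : lookup switched i ≡ switch (lookup w i) s
    at-i = Vec.lookup∘updateAt i w

    elsewhere : ∀ {j} → j ≢ i → lookup switched j ≡ lookup w j
    elsewhere j≢i = Vec.lookup∘updateAt′ _ i j≢i w

    end-old : ∀ {j h} → lookup switched j ≡ end h → lookup w j ≡ end h
    end-old {j} eq with j Fin.≟ i
    ... | yes refl = contradiction (trans (sym at-i) eq) (switch-mid (lookup w i) s _)
    ... | no j≢i   = trans (sym (elsewhere j≢i)) eq

    local : ∀ j s′ → rep w j (canon (lookup w j) s′) ≡ rep w i s ⊎ pos (lookup w j) s′ ≡ pos (lookup switched j) s′
    local j s′ with j Fin.≟ i
    ... | no j≢i   = inj₂ (cong (λ l → pos l s′) (sym (elsewhere j≢i)))
    ... | yes refl with switch-local (lookup w i) s′ s∈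
    ...   | inj₁ eq = inj₁ (cong (rep w i) eq)
    ...   | inj₂ eq = inj₂ (trans eq (cong (λ l → pos l s′) (sym at-i)))

  switched-valid : Valid w → Valid switched
  switched-valid v j j′ eq p q = v j j′ eq (end-old p) (end-old q)

  switched-off : ¬ On switched (rep w i s)
  switched-off on = switch-pos (lookup w i) s (trans (cong (λ l → pos l s) (sym at-i)) on)

  switched-key : ∀ x → On w x → ¬ On switched x → key w x ≡ rep w i s
  switched-key (hor s′ j p) on off with local j s′
  ... | inj₁ eq = eq
  ... | inj₂ eq = contradiction (trans (sym eq) on) off
  switched-key (cap s′ j h) on off with local j s′
  ... | inj₁ eq = eq
  ... | inj₂ eq = contradiction (trans (cong half (sym eq)) on) off
  switched-key (rung s′ j h) on off with local j s′
  ... | inj₁ eq = eq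
  ... | inj₂ eq = contradiction (on ∘ trans (cong half eq)) off
  switched-key (mid j) on off with j Fin.≟ i
  ... | no j≢i   = contradiction (subst IsEnd (sym (elsewhere j≢i)) on) off
  ... | yes refl = cong (rep w i) (sym (only-top on s∈))
    where
    only-top : ∀ {l s} → IsEnd l → s ∈ₗ sides l → s ≡ top
    only-top isEnd (here eq) = eq
  switched-key (bnd k) on off = contradiction (λ (j , h , eq , l) → on (j , h , eq , end-old l)) off

-- Counting words

count countNonLeft : ∀ n → ℕ → ℤ
count        n = coeff (enumerator mids (words n))
countNonLeft n = coeff (enumerator mids (nonLeftWords n))

count-left : ∀ n k → count (suc n) k ≡ count n k +ᶻ countNonLeft (suc n) k
count-left n k = trans (enumerator-++ mids (map (end left ∷_) (words n)) (nonLeftWords (suc n)) k)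
  (cong (λ p → coeff p k +ᶻ countNonLeft (suc n) k) (enumerator-map mids (end left ∷_) (words n)))

countNonLeft-suc : ∀ n k → countNonLeft (suc n) k ≡ (+ 4) *ᶻ shift 1 (count n) k +ᶻ countNonLeft n k
countNonLeft-suc n k = begin
  countNonLeft (suc n) k
    ≡⟨ enumerator-++ mids (cartesianProductWith _∷_ midLetters (words n)) _ k ⟩
  coeff (enumerator mids (cartesianProductWith _∷_ midLetters (words n))) k +ᶻ coeff (enumerator mids (map (end right ∷_) (nonLeftWords n))) k
    ≡⟨ cong₂ _+ᶻ_ four (cong (λ p → coeff p k) (enumerator-map mids (end right ∷_) (nonLeftWords n))) ⟩
  (+ 4) *ᶻ shift 1 (count n) k +ᶻ countNonLeft n k ∎
  where
  open ≡-Reasoning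
  one : ∀ a b → coeff (enumerator mids (map (mid a b ∷_) (words n))) k ≡ shift 1 (count n) k
  one a b = trans (cong (λ p → coeff p k) (enumerator-map mids (mid a b ∷_) (words n)))
    (enumerator-shift 1 mids (words n) k)
  add : ∀ c → c +ᶻ (c +ᶻ (c +ᶻ (c +ᶻ 0ℤ))) ≡ (+ 4) *ᶻ c
  add = solve-∀
  four : coeff (enumerator mids (cartesianProductWith _∷_ midLetters (words n))) k ≡ (+ 4) *ᶻ shift 1 (count n) k
  four = trans (trans (step left left _) (cong (shift 1 (count n) k +ᶻ_) (trans (step left right _)
    (cong (shift 1 (count n) k +ᶻ_) (trans (step right left _) (cong (shift 1 (count n) k +ᶻ_) (step right right [])))))))
    (add (shift 1 (count n) k))
    where
    step : ∀ a b ws → coeff (enumerator mids (map (mid a b ∷_) (words n) ++ ws)) k ≡ shift 1 (count n) k +ᶻ coeff (enumerator mids ws) k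
    step a b ws = trans (enumerator-++ mids (map (mid a b ∷_) (words n)) ws k) (cong (_+ᶻ coeff (enumerator mids ws) k) (one a b))

-- Every word of length n + 1 may be preceded by any letter, except that end right
-- must not precede one of the count n k words starting with end left.
count-rec : ∀ n k → count (2 + n) k ≡ (+ 2) *ᶻ count (1 + n) k +ᶻ (+ 4) *ᶻ shift 1 (count (1 + n)) k -ᶻ count n k
count-rec n k rewrite count-left (suc n) k | countNonLeft-suc (suc n) k | count-left n k =
  ring (count n k) (countNonLeft (suc n) k) (shift 1 (count (suc n)) k)
  where
  ring : ∀ c d e → (c +ᶻ d) +ᶻ ((+ 4) *ᶻ e +ᶻ d) ≡ (+ 2) *ᶻ (c +ᶻ d) +ᶻ (+ 4) *ᶻ e -ᶻ c
  ring = solve-∀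

count≡total : ∀ n k → count n k ≡ total n k
count≡total zero          zero    = refl
count≡total zero          (suc k) = sym (cong₂ _+ᶻ_ (term-vanish {0} {0} {suc k} (s≤s z≤n)) refl)
count≡total (suc zero)    0       = refl
count≡total (suc zero)    1       = refl
count≡total (suc zero)    (suc (suc k)) = sym (sumTo-0 2 {λ i → term 1 i (2 + k)} λ
  { 0 _ → term-vanish {1} {0} {2 + k} (s≤s z≤n)
  ; 1 _ → term-vanish {1} {1} {2 + k} (s≤s (s≤s (ℕ.m≤n+m 1 k)))
  ; (suc (suc _)) (s≤s (s≤s ())) })
count≡total (suc (suc n)) k = begin
  count (2 + n) k
    ≡⟨ count-rec n k ⟩
  (+ 2) *ᶻ count (1 + n) k +ᶻ (+ 4) *ᶻ shift 1 (count (1 + n)) k -ᶻ count n k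
    ≡⟨ cong₂ _-ᶻ_ (cong₂ (λ a b → (+ 2) *ᶻ a +ᶻ (+ 4) *ᶻ b) (count≡total (suc n) k) (shift-cong 1 (count≡total (suc n)) k)) (count≡total n k) ⟩
  (+ 2) *ᶻ total (1 + n) k +ᶻ (+ 4) *ᶻ shift 1 (total (1 + n)) k -ᶻ total n k
    ≡⟨ total-rec n k ⟨
  total (2 + n) k ∎
  where open ≡-Reasoning

-- Coordinates

quad : ℕ → ℕ
quad zero    = 0
quad (suc i) = 4 + quad i

quad≡4* : ∀ i → quad i ≡ 4 * i
quad≡4* zero    = refl
quad≡4* (suc i) = trans (cong (λ a → 4 + a) (quad≡4* i)) (sym (ℕ.*-suc 4 i))

cells : ℕ → List Hexagon
cells a = (a , 1) ∷ (2 + a , 1) ∷ (1 + a , 2) ∷ (1 + a , 0) ∷ []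

fragment≡cells : ∀ i → fragment i ≡ cells (quad i)
fragment≡cells i rewrite quad≡4* i | ℕ.+-comm (4 * i) 2 | ℕ.+-comm (4 * i) 1 = refl

innerRow outerRow : Side → ℕ
innerRow top = 2
innerRow bot = 1
outerRow top = 3
outerRow bot = 0

column : Half → ℕ
column left  = 1
column right = 3

point : Node n → Point
point (bd k s)    = quad (toℕ k) , innerRow s
point (inn s i h) = column h + quad (toℕ i) , innerRow s
point (tip s i h) = column h + quad (toℕ i) , outerRow s
point (ctr s i)   = 2 + quad (toℕ i) , innerRow s
point (apex s i)  = 2 + quad (toℕ i) , outerRow s

source target : Bond n → Node n
source (hor s i (outer left))  = bd (inject₁ i) s
source (hor s i (outer right)) = inn s i right
source (hor s i (inner left))  = inn s i left
source (hor s i (inner right)) = ctr s i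
source (cap s i left)          = tip s i left
source (cap s i right)         = apex s i
source (rung top i h)          = inn top i h
source (rung bot i h)          = tip bot i h
source (mid i)                 = ctr bot i
source (bnd k)                 = bd k bot
target (hor s i (outer left))  = inn s i left
target (hor s i (outer right)) = bd (suc i) s
target (hor s i (inner left))  = ctr s i
target (hor s i (inner right)) = inn s i right
target (cap s i left)          = apex s i
target (cap s i right)         = tip s i right
target (rung top i h)          = tip top i h
target (rung bot i h)          = inn bot i h
target (mid i)                 = ctr top i
target (bnd k)                 = bd k top

segment : Bond n → Point × Point
segment x = point (source x) , point (target x)

inc⁻ : ∀ {u : Node n} {x} → Inc u x → u ≡ source x ⊎ u ≡ target x
inc⁻ (bdO {h = left}  refl) = inj₁ refl
inc⁻ (bdO {h = right} refl) = inj₂ refl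
inc⁻ (bdB {s = top})    = inj₂ refl
inc⁻ (bdB {s = bot})    = inj₁ refl
inc⁻ (innO {h = left})  = inj₂ refl
inc⁻ (innO {h = right}) = inj₁ refl
inc⁻ (innI {h = left})  = inj₁ refl
inc⁻ (innI {h = right}) = inj₂ refl
inc⁻ (innR {s = top})   = inj₁ refl
inc⁻ (innR {s = bot})   = inj₂ refl
inc⁻ (ctrI {h = left})  = inj₂ refl
inc⁻ (ctrI {h = right}) = inj₁ refl
inc⁻ (ctrM {s = top})   = inj₂ refl
inc⁻ (ctrM {s = bot})   = inj₁ refl
inc⁻ (tipC {h = left})  = inj₁ refl
inc⁻ (tipC {h = right}) = inj₂ refl
inc⁻ (tipR {s = top})   = inj₂ refl
inc⁻ (tipR {s = bot})   = inj₁ refl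
inc⁻ (apexC {h = left}) = inj₂ refl
inc⁻ (apexC {h = right}) = inj₁ refl

inc-source : (x : Bond n) → Inc (source x) x
inc-source (hor s i (outer left))  = bdO refl
inc-source (hor s i (outer right)) = innO
inc-source (hor s i (inner left))  = innI
inc-source (hor s i (inner right)) = ctrI
inc-source (cap s i left)          = tipC
inc-source (cap s i right)         = apexC
inc-source (rung top i h)          = innR
inc-source (rung bot i h)          = tipR
inc-source (mid i)                 = ctrM
inc-source (bnd k)                 = bdB

inc-target : (x : Bond n) → Inc (target x) x
inc-target (hor s i (outer left))  = innO
inc-target (hor s i (outer right)) = bdO refl
inc-target (hor s i (inner left))  = ctrI
inc-target (hor s i (inner right)) = innI
inc-target (cap s i left)          = apexC
inc-target (cap s i right)         = tipC
inc-target (rung top i h)          = tipR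
inc-target (rung bot i h)          = innR
inc-target (mid i)                 = ctrM
inc-target (bnd k)                 = bdB

data Shape : Set where
  bd ctr apex : Side → Shape
  inn tip     : Side → Half → Shape

shape : Node n → Shape
shape (bd _ s)    = bd s
shape (inn s _ h) = inn s h
shape (tip s _ h) = tip s h
shape (ctr s _)   = ctr s
shape (apex s _)  = apex s

place : Node n → ℕ
place (bd k _)    = toℕ k
place (inn _ i _) = toℕ i
place (tip _ i _) = toℕ i
place (ctr _ i)   = toℕ i
place (apex _ i)  = toℕ i

shape-place-injective : (u v : Node n) → shape u ≡ shape v → place u ≡ place v → u ≡ v
shape-place-injective (bd _ s)    (bd _ _)    refl eq = cong (λ k → bd k s)    (Fin.toℕ-injective eq)
shape-place-injective (inn s _ h) (inn _ _ _) refl eq = cong (λ i → inn s i h) (Fin.toℕ-injective eq)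
shape-place-injective (tip s _ h) (tip _ _ _) refl eq = cong (λ i → tip s i h) (Fin.toℕ-injective eq)
shape-place-injective (ctr s _)   (ctr _ _)   refl eq = cong (ctr s)           (Fin.toℕ-injective eq)
shape-place-injective (apex s _)  (apex _ _)  refl eq = cong (apex s)          (Fin.toℕ-injective eq)

-- Inverse to point; the values off the pyrene system are junk.
shapeAt : Point → Shape
shapeAt (suc (suc (suc (suc x))) , y) = shapeAt (x , y)
shapeAt (0 , 1) = bd bot
shapeAt (0 , _) = bd top
shapeAt (1 , 0) = tip bot left
shapeAt (1 , 1) = inn bot left
shapeAt (1 , 2) = inn top left
shapeAt (1 , _) = tip top left
shapeAt (2 , 0) = apex bot
shapeAt (2 , 1) = ctr bot
shapeAt (2 , 2) = ctr top
shapeAt (2 , _) = apex top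
shapeAt (3 , 0) = tip bot right
shapeAt (3 , 1) = inn bot right
shapeAt (3 , 2) = inn top right
shapeAt (3 , _) = tip top right

div4 : ℕ → ℕ
div4 (suc (suc (suc (suc x)))) = suc (div4 x)
div4 _                         = 0

+-quad-suc : ∀ r i → r + quad (suc i) ≡ 4 + (r + quad i)
+-quad-suc r i = trans (sym (ℕ.+-assoc r 4 (quad i))) (cong (_+ quad i) (ℕ.+-comm r 4))

shapeAt-quad : ∀ r i y → shapeAt (r + quad i , y) ≡ shapeAt (r , y)
shapeAt-quad r zero    y = cong (λ x → shapeAt (x , y)) (ℕ.+-identityʳ r)
shapeAt-quad r (suc i) y = trans (cong (λ x → shapeAt (x , y)) (+-quad-suc r i)) (shapeAt-quad r i y)

div4-quad : ∀ r i → div4 (r + quad i) ≡ div4 r + i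
div4-quad r zero    = trans (cong div4 (ℕ.+-identityʳ r)) (sym (ℕ.+-identityʳ (div4 r)))
div4-quad r (suc i) = trans (cong div4 (+-quad-suc r i)) (trans (cong suc (div4-quad r i)) (sym (ℕ.+-suc (div4 r) i)))

shapeAt-point : (u : Node n) → shapeAt (point u) ≡ shape u
shapeAt-point (bd k top)        = shapeAt-quad 0 (toℕ k) _
shapeAt-point (bd k bot)        = shapeAt-quad 0 (toℕ k) _
shapeAt-point (inn top i left)  = shapeAt-quad 1 (toℕ i) _
shapeAt-point (inn top i right) = shapeAt-quad 3 (toℕ i) _
shapeAt-point (inn bot i left)  = shapeAt-quad 1 (toℕ i) _
shapeAt-point (inn bot i right) = shapeAt-quad 3 (toℕ i) _
shapeAt-point (tip top i left)  = shapeAt-quad 1 (toℕ i) _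
shapeAt-point (tip top i right) = shapeAt-quad 3 (toℕ i) _
shapeAt-point (tip bot i left)  = shapeAt-quad 1 (toℕ i) _
shapeAt-point (tip bot i right) = shapeAt-quad 3 (toℕ i) _
shapeAt-point (ctr top i)       = shapeAt-quad 2 (toℕ i) _
shapeAt-point (ctr bot i)       = shapeAt-quad 2 (toℕ i) _
shapeAt-point (apex top i)      = shapeAt-quad 2 (toℕ i) _
shapeAt-point (apex bot i)      = shapeAt-quad 2 (toℕ i) _

div4-point : (u : Node n) → div4 (proj₁ (point u)) ≡ place u
div4-point (bd k _)        = div4-quad 0 (toℕ k)
div4-point (inn _ i left)  = div4-quad 1 (toℕ i)
div4-point (inn _ i right) = div4-quad 3 (toℕ i)
div4-point (tip _ i left)  = div4-quad 1 (toℕ i)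
div4-point (tip _ i right) = div4-quad 3 (toℕ i)
div4-point (ctr _ i)       = div4-quad 2 (toℕ i)
div4-point (apex _ i)      = div4-quad 2 (toℕ i)

point-injective : {u v : Node n} → point u ≡ point v → u ≡ v
point-injective {u = u} {v} eq = shape-place-injective u v
  (trans (sym (shapeAt-point u)) (trans (cong shapeAt eq) (shapeAt-point v)))
  (trans (sym (div4-point u)) (trans (cong (div4 ∘ proj₁) eq) (div4-point v)))

-- Inverse to x ↦ (source x , target x), with a junk last value.
bondOf : Node n → Node n → Bond n
bondOf (bd _ _)    (inn s i h) = hor s i (outer h)
bondOf (inn s i h) (bd _ _)    = hor s i (outer h)
bondOf (inn s i h) (ctr _ _)   = hor s i (inner h)
bondOf (ctr _ _)   (inn s i h) = hor s i (inner h)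
bondOf (tip s i h) (apex _ _)  = cap s i h
bondOf (apex _ _)  (tip s i h) = cap s i h
bondOf (inn s i h) (tip _ _ _) = rung s i h
bondOf (tip s i h) (inn _ _ _) = rung s i h
bondOf (ctr _ i)   (ctr _ _)   = mid i
bondOf (bd k _)    (bd _ _)    = bnd k
bondOf _           _           = bnd zero

bondOf-ends : (x : Bond n) → bondOf (source x) (target x) ≡ x
bondOf-ends (hor s i (outer left))  = refl
bondOf-ends (hor s i (outer right)) = refl
bondOf-ends (hor s i (inner left))  = refl
bondOf-ends (hor s i (inner right)) = refl
bondOf-ends (cap s i left)          = refl
bondOf-ends (cap s i right)         = refl
bondOf-ends (rung top i h)          = refl
bondOf-ends (rung bot i h)          = refl
bondOf-ends (mid i)                 = refl
bondOf-ends (bnd k)                 = refl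

segment-injective : {x y : Bond n} → segment x ≡ segment y → x ≡ y
segment-injective {x = x} {y} eq = trans (sym (bondOf-ends x)) (trans
  (cong₂ bondOf (point-injective (cong proj₁ eq)) (point-injective (cong proj₂ eq))) (bondOf-ends y))

cellNodes : ∀ {n} (i : Fin n) → All (λ v → ∃ λ (u : Node n) → v ≡ point u) (concatMap hexVertices (cells (quad (toℕ i))))
cellNodes {n} i =
  (bd (inject₁ i) top , border-point top) ∷ (inn top i left , refl) ∷ (ctr top i , refl) ∷
  (bd (inject₁ i) bot , border-point bot) ∷ (inn bot i left , refl) ∷ (ctr bot i , refl) ∷
  (ctr top i , refl) ∷ (inn top i right , refl) ∷ (bd (suc i) top , refl) ∷
  (ctr bot i , refl) ∷ (inn bot i right , refl) ∷ (bd (suc i) bot , refl) ∷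
  (tip top i left , refl) ∷ (apex top i , refl) ∷ (tip top i right , refl) ∷
  (inn top i left , refl) ∷ (ctr top i , refl) ∷ (inn top i right , refl) ∷
  (inn bot i left , refl) ∷ (ctr bot i , refl) ∷ (inn bot i right , refl) ∷
  (tip bot i left , refl) ∷ (apex bot i , refl) ∷ (tip bot i right , refl) ∷ []
  where
  border-point : ∀ s → (quad (toℕ i) , innerRow s) ≡ point {n} (bd (inject₁ i) s)
  border-point s = cong (λ k → quad k , innerRow s) (sym (Fin.toℕ-inject₁ i))

left-segment : ∀ (i : Fin n) s →
  segment (hor s i (outer left)) ≡ ((quad (toℕ i) , innerRow s) , (1 + quad (toℕ i) , innerRow s))
left-segment i s = cong (λ k → (quad k , innerRow s) , (1 + quad (toℕ i) , innerRow s)) (Fin.toℕ-inject₁ i)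

cellBonds : ∀ {n} (i : Fin n) → All (λ p → ∃ λ (x : Bond n) → p ≡ segment x) (concatMap hexEdges (cells (quad (toℕ i))))
cellBonds {n} i =
  (hor top i (outer left) , sym (left-segment i top)) ∷ (hor top i (inner left) , refl) ∷
  (hor bot i (outer left) , sym (left-segment i bot)) ∷ (hor bot i (inner left) , refl) ∷
  (bnd (inject₁ i) , left-border) ∷ (mid i , refl) ∷
  (hor top i (inner right) , refl) ∷ (hor top i (outer right) , refl) ∷
  (hor bot i (inner right) , refl) ∷ (hor bot i (outer right) , refl) ∷
  (mid i , refl) ∷ (bnd (suc i) , refl) ∷
  (cap top i left , refl) ∷ (cap top i right , refl) ∷
  (hor top i (inner left) , refl) ∷ (hor top i (inner right) , refl) ∷
  (rung top i left , refl) ∷ (rung top i right , refl) ∷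
  (hor bot i (inner left) , refl) ∷ (hor bot i (inner right) , refl) ∷
  (cap bot i left , refl) ∷ (cap bot i right , refl) ∷
  (rung bot i left , refl) ∷ (rung bot i right , refl) ∷ []
  where
  left-border : ((quad (toℕ i) , 1) , (quad (toℕ i) , 2)) ≡ segment {n} (bnd (inject₁ i))
  left-border = cong (λ k → (quad k , 1) , (quad k , 2)) (sym (Fin.toℕ-inject₁ i))

segment∈ : (x : Bond (suc n)) → ∃ λ (i : Fin (suc n)) → segment x ∈ₗ concatMap hexEdges (cells (quad (toℕ i)))
segment∈ (hor top i (outer left))  = i , Any.map (trans (left-segment i top)) (∈-lookup (# 0))
segment∈ (hor bot i (outer left))  = i , Any.map (trans (left-segment i bot)) (∈-lookup (# 2))
segment∈ (hor top i (outer right)) = i , ∈-lookup (# 7)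
segment∈ (hor bot i (outer right)) = i , ∈-lookup (# 9)
segment∈ (hor top i (inner left))  = i , ∈-lookup (# 1)
segment∈ (hor bot i (inner left))  = i , ∈-lookup (# 3)
segment∈ (hor top i (inner right)) = i , ∈-lookup (# 6)
segment∈ (hor bot i (inner right)) = i , ∈-lookup (# 8)
segment∈ (cap top i left)   = i , ∈-lookup (# 12)
segment∈ (cap top i right)  = i , ∈-lookup (# 13)
segment∈ (cap bot i left)   = i , ∈-lookup (# 20)
segment∈ (cap bot i right)  = i , ∈-lookup (# 21)
segment∈ (rung top i left)  = i , ∈-lookup (# 16)
segment∈ (rung top i right) = i , ∈-lookup (# 17)
segment∈ (rung bot i left)  = i , ∈-lookup (# 22)
segment∈ (rung bot i right) = i , ∈-lookup (# 23)
segment∈ (mid i)            = i , ∈-lookup (# 5)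
segment∈ (bnd zero)         = zero , ∈-lookup (# 4)
segment∈ (bnd (suc i))      = i , ∈-lookup (# 11)

-- Forcing numbers

allSubsets-unique : ∀ m → Unique (allSubsets m)
allSubsets-unique zero    = [] ∷ []
allSubsets-unique (suc m) = Unique.++⁺
  (Unique.map⁺ Vec.∷-injectiveʳ (allSubsets-unique m)) (Unique.map⁺ Vec.∷-injectiveʳ (allSubsets-unique m))
  λ (p , q) → case ∈-map⁻ _ p , ∈-map⁻ _ q of λ { ((_ , _ , refl) , (_ , _ , ())) }

fromList : ∀ {m} → List (Fin m) → Subset m
fromList = foldr (λ i p → ⁅ i ⁆ ∪ p) ⊥

∈-fromList⁺ : ∀ {m} {i : Fin m} {is} → i ∈ₗ is → i ∈ fromList is
∈-fromList⁺ (here refl) = x∈p∪q⁺ (inj₁ (x∈⁅x⁆ _))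
∈-fromList⁺ (there i∈)  = x∈p∪q⁺ (inj₂ (∈-fromList⁺ i∈))

∈-fromList⁻ : ∀ {m} {i : Fin m} is → i ∈ fromList is → i ∈ₗ is
∈-fromList⁻ []       i∈ = contradiction i∈ ∉⊥
∈-fromList⁻ (j ∷ is) i∈ with x∈p∪q⁻ ⁅ j ⁆ (fromList is) i∈
... | inj₁ i∈j  = here (x∈⁅y⁆⇒x≡y j i∈j)
... | inj₂ i∈is = there (∈-fromList⁻ is i∈is)

∣p∪q∣≤∣p∣+∣q∣ : ∀ {m} (p q : Subset m) → ∣ p ∪ q ∣ ≤ ∣ p ∣ + ∣ q ∣
∣p∪q∣≤∣p∣+∣q∣ []            []            = z≤n
∣p∪q∣≤∣p∣+∣q∣ (outside ∷ p) (outside ∷ q) = ∣p∪q∣≤∣p∣+∣q∣ p q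
∣p∪q∣≤∣p∣+∣q∣ (outside ∷ p) (inside ∷ q)  = ℕ.≤-trans (s≤s (∣p∪q∣≤∣p∣+∣q∣ p q)) (ℕ.≤-reflexive (sym (ℕ.+-suc ∣ p ∣ ∣ q ∣)))
∣p∪q∣≤∣p∣+∣q∣ (inside ∷ p)  (outside ∷ q) = s≤s (∣p∪q∣≤∣p∣+∣q∣ p q)
∣p∪q∣≤∣p∣+∣q∣ (inside ∷ p)  (inside ∷ q)  = s≤s (ℕ.≤-trans (∣p∪q∣≤∣p∣+∣q∣ p q) (ℕ.+-monoʳ-≤ ∣ p ∣ (ℕ.n≤1+n ∣ q ∣)))

∣fromList∣ : ∀ {m} (is : List (Fin m)) → ∣ fromList is ∣ ≤ length is
∣fromList∣ {m} []   = ℕ.≤-reflexive (∣⊥∣≡0 m)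
∣fromList∣ (i ∷ is) = ℕ.≤-trans (∣p∪q∣≤∣p∣+∣q∣ ⁅ i ⁆ (fromList is))
  (ℕ.+-mono-≤ (ℕ.≤-reflexive (∣⁅x⁆∣≡1 i)) (∣fromList∣ is))

req-on : (w : Word n) → ∀ {x} → x ∈ₗ req w → On w x
req-on w x∈ with ∈-req⁻ w x∈
... | _ , _ , _ , refl = refl

unique-↭ : {A : Set} {xs ys : List A} → Unique xs → Unique ys →
  (∀ {x} → x ∈ₗ xs → x ∈ₗ ys) → (∀ {x} → x ∈ₗ ys → x ∈ₗ xs) → xs ↭ ys
unique-↭ xs! ys! to from = ∼bag⇒↭ (unique∧set⇒bag xs! ys! (mk⇔ to from))

module _ (G : Graph) where
  open Forcing G

  perfectMatchings-unique : Unique perfectMatchings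
  perfectMatchings-unique = Unique.filter⁺ isPerfectMatching? (allSubsets-unique _)

  ∈-perfectMatchings⁺ : ∀ {M} → IsPerfectMatching M → M ∈ₗ perfectMatchings
  ∈-perfectMatchings⁺ pm = ∈-filter⁺ isPerfectMatching? (∈-allSubsets _) pm

  ∈-perfectMatchings⁻ : ∀ {M} → M ∈ₗ perfectMatchings → IsPerfectMatching M
  ∈-perfectMatchings⁻ M∈ = proj₂ (∈-filter⁻ isPerfectMatching? {xs = allSubsets _} M∈)

-- An isomorphism with the symbolic graph of Node, Bond and Inc; arguing for an arbitrary
-- such G keeps the deduplicated vertex and edge lists of the pyrene system folded.
record Labelling (G : Graph) (n : ℕ) : Set where
  open Graph G using (V; Edge; vertices)
  open Forcing G using (Incident)
  field
    position       : Node n → V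
    vertex-node    : ∀ {v} → v ∈ₗ vertices → ∃ λ u → v ≡ position u
    node∈vertices  : ∀ u → position u ∈ₗ vertices
    edge           : Bond n → Edge
    name           : Edge → Bond n
    name-edge      : ∀ x → name (edge x) ≡ x
    edge-name      : ∀ e → edge (name e) ≡ e
    incident⁺      : ∀ {u e} → Inc u (name e) → Incident (position u) e
    incident⁻      : ∀ {u e} → Incident (position u) e → Inc u (name e)

module _ {G : Graph} (labelling : Labelling G n) where
  open Graph G using (vertices; ends∈vertices)
  open Forcing G hiding (forcingPolynomial)
  open Labelling labelling

  private
    name-injective : ∀ {e e′} → name e ≡ name e′ → e ≡ e′
    name-injective {e} {e′} eq = trans (sym (edge-name e)) (trans (cong edge eq) (edge-name e′))

  perfect⇒exactCover : ∀ {M} → IsPerfectMatching M → ExactCover (λ x → edge x ∈ M)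
  perfect⇒exactCover {M} (matching , covering) = record { covers = covers ; unique = unique }
    where
    covers : ∀ u → ∃ λ x → edge x ∈ M × Inc u x
    covers u with All.lookup covering (node∈vertices u)
    ... | e , e∈M , inc = name e , subst (_∈ M) (sym (edge-name e)) e∈M , incident⁻ inc
    meets : ∀ {u x} → Inc u x → Incident (position u) (edge x)
    meets {u} inc = incident⁺ (subst (Inc u) (sym (name-edge _)) inc)
    unique : ∀ {u x y} → edge x ∈ M → edge y ∈ M → Inc u x → Inc u y → x ≡ y
    unique {x = x} {y} x∈ y∈ p q = trans (sym (name-edge x)) (trans
      (cong name (matching (edge x) (edge y) x∈ y∈ (_ , meets p , meets q))) (name-edge y))

  exactCover⇒perfect : ∀ {M} → ExactCover (λ x → edge x ∈ M) → IsPerfectMatching M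
  exactCover⇒perfect {M} cover = matching , All.tabulate covering
    where
    open ExactCover cover
    named∈ : ∀ {e} → e ∈ M → edge (name e) ∈ M
    named∈ {e} = subst (_∈ M) (sym (edge-name e))
    end∈ : ∀ {v e} → Incident v e → v ∈ₗ vertices
    end∈ {e = e} (inj₁ refl) = proj₁ (ends∈vertices e)
    end∈ {e = e} (inj₂ refl) = proj₂ (ends∈vertices e)
    matching : IsMatching M
    matching e e′ e∈ e′∈ (v , p , q) with vertex-node (end∈ p)
    ... | u , refl = name-injective (unique (named∈ e∈) (named∈ e′∈) (incident⁻ p) (incident⁻ q))
    covering : ∀ {v} → v ∈ₗ vertices → ∃ λ e → e ∈ M × Incident v e
    covering v∈ with vertex-node v∈
    ... | u , refl with covers u
    ...   | x , x∈ , inc = edge x , x∈ , incident⁺ (subst (Inc u) (sym (name-edge x)) inc)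

  encode : Word n → EdgeSet
  encode w = tabulate (λ e → does (on? w (name e)))

  ∈-encode⁺ : ∀ {w e} → On w (name e) → e ∈ encode w
  ∈-encode⁺ {w} {e} on = Vec.lookup⇒[]= e _ (trans (Vec.lookup∘tabulate _ e) (dec-true (on? w (name e)) on))

  ∈-encode⁻ : ∀ {w e} → e ∈ encode w → On w (name e)
  ∈-encode⁻ {w} {e} e∈ with on? w (name e) in eq
  ... | yes on = on
  ... | no _ with () ← trans (sym (Vec.[]=⇒lookup e∈)) (trans (Vec.lookup∘tabulate _ e) (cong does eq))

  edge∈-encode⁺ : ∀ {w x} → On w x → edge x ∈ encode w
  edge∈-encode⁺ {w} {x} on = ∈-encode⁺ (subst (On w) (sym (name-edge x)) on)

  edge∈-encode⁻ : ∀ {w x} → edge x ∈ encode w → On w x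
  edge∈-encode⁻ {w} {x} x∈ = subst (On w) (name-edge x) (∈-encode⁻ x∈)

  encode-perfect : ∀ {w} → Valid w → IsPerfectMatching (encode w)
  encode-perfect {w} v = exactCover⇒perfect record
    { covers = λ u → let x , on , inc = covers u in x , edge∈-encode⁺ on , inc
    ; unique = λ p q → unique (edge∈-encode⁻ p) (edge∈-encode⁻ q)
    }
    where open ExactCover (on-exactCover {w = w} v)

  perfect-encode : ∀ {M} → IsPerfectMatching M → ∃ λ w → Valid w × M ≡ encode w
  perfect-encode {M} pm = word cover , word-valid cover , ⊆-antisym
    (λ {e} e∈ → ∈-encode⁺ (⇒on cover (name e) (subst (_∈ M) (sym (edge-name e)) e∈)))
    (λ {e} e∈ → subst (_∈ M) (edge-name e) (on⇒ cover (name e) (∈-encode⁻ e∈)))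
    where cover = perfect⇒exactCover pm

  encode-injective : ∀ {w w′} → encode w ≡ encode w′ → w ≡ w′
  encode-injective {w} {w′} eq = sym (req-forces w w′ λ x∈ →
    edge∈-encode⁻ (subst (_ ∈_) eq (edge∈-encode⁺ (req-on w x∈))))

  perfectMatchings-↭ : perfectMatchings ↭ map encode (words n)
  perfectMatchings-↭ = unique-↭ (perfectMatchings-unique G)
    (Unique.map⁺ encode-injective (words-unique n)) to from
    where
    to : ∀ {M} → M ∈ₗ perfectMatchings → M ∈ₗ map encode (words n)
    to M∈ with perfect-encode (∈-perfectMatchings⁻ G M∈)
    ... | w , v , refl = ∈-map⁺ encode (∈-words w v)
    from : ∀ {M} → M ∈ₗ map encode (words n) → M ∈ₗ perfectMatchings
    from M∈ with ∈-map⁻ encode M∈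
    ... | w , w∈ , refl = ∈-perfectMatchings⁺ G (encode-perfect (words-valid n w∈))

  forcingNumber-≤ : ∀ {w} → Valid w → forcingNumber (encode w) ≤ length (req w)
  forcingNumber-≤ {w} v = ℕ.≤-trans
    (forcingNumber-minimal (encode w) (fromList es) (sub , forces))
    (ℕ.≤-trans (∣fromList∣ es) (ℕ.≤-reflexive (List.length-map edge (req w))))
    where
    es = map edge (req w)
    sub : fromList es ⊆ encode w
    sub e∈ with ∈-map⁻ edge (∈-fromList⁻ es e∈)
    ... | x , x∈ , refl = edge∈-encode⁺ (req-on w x∈)
    forces : ∀ M′ → IsPerfectMatching M′ → fromList es ⊆ M′ → M′ ≡ encode w
    forces M′ pm es⊆ with perfect-encode pm
    ... | w′ , _ , refl = cong encode (req-forces w w′ λ x∈ → edge∈-encode⁻ (es⊆ (∈-fromList⁺ (∈-map⁺ edge x∈))))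

  forcing-meets : ∀ {w S} → Valid w → IsForcingSet (encode w) S → ∀ {r} → r ∈ₗ req w →
    ∃ λ e → e ∈ S × key w (name e) ≡ r
  forcing-meets {w} {S} v (S⊆ , forces) r∈ with ∈-req⁻ w r∈
  ... | i , s , s∈ , refl with Fin.any? (λ e → (e ∈? S) ×-dec ¬? (e ∈? encode (switched w i s∈)))
  ...   | yes (e , e∈ , e∉) =
    e , e∈ , switched-key w i s∈ (name e) (∈-encode⁻ (S⊆ e∈)) (e∉ ∘ ∈-encode⁺)
  ...   | no ¬e = contradiction
    (edge∈-encode⁻ {x = rep w i s} (subst (edge (rep w i s) ∈_) (sym same) (edge∈-encode⁺ {x = rep w i s} refl)))
    (switched-off w i s∈)
    where
    same : encode (switched w i s∈) ≡ encode w
    same = forces _ (encode-perfect (switched-valid w i s∈ v))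
      λ {e} e∈ → decidable-stable (e ∈? _) λ e∉ → ¬e (e , e∈ , e∉)

  forcing-≥ : ∀ {w S} → Valid w → IsForcingSet (encode w) S → length (req w) ≤ ∣ S ∣
  forcing-≥ {w} {S} v fs = go (req-unique w) λ r∈ → forcing-meets v fs r∈
    where
    go : ∀ {rs S} → Unique rs → (∀ {r} → r ∈ₗ rs → ∃ λ e → e ∈ S × key w (name e) ≡ r) → length rs ≤ ∣ S ∣
    go {[]}     _          _     = z≤n
    go {r ∷ rs} {S} (r∉ ∷ rs!) meets with meets (here refl)
    ... | e , e∈ , refl = ℕ.≤-trans (s≤s (go rs! rest)) (x∈p⇒∣p-x∣<∣p∣ e∈)
      where
      rest : ∀ {r} → r ∈ₗ rs → ∃ λ e′ → e′ ∈ S - e × key w (name e′) ≡ r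
      rest r∈ with meets (there r∈)
      ... | e′ , e′∈ , refl = e′ , x∈p∧x≢y⇒x∈p-y e′∈ (λ { refl → All.lookup r∉ r∈ refl }) , refl

  forcingNumber-encode : ∀ {w} → Valid w → forcingNumber (encode w) ≡ n + mids w
  forcingNumber-encode {w} v with forcingNumber-attained (encode w) (encode-perfect v)
  ... | S , fs , eq = trans (ℕ.≤-antisym (forcingNumber-≤ v) (subst (_ ≤_) eq (forcing-≥ v fs))) (length-req w)

  forcingPolynomial-count : ∀ k → coeff (forcingPolynomial G) k ≡ shift n (count n) k
  forcingPolynomial-count k = begin
    coeff (enumerator forcingNumber perfectMatchings) k
      ≡⟨ sumₚ-↭ (↭.map⁺ (λ M → x^ forcingNumber M) perfectMatchings-↭) k ⟩
    coeff (enumerator forcingNumber (map encode (words n))) k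
      ≡⟨ cong (λ p → coeff p k) (enumerator-map forcingNumber encode (words n)) ⟩
    coeff (enumerator (forcingNumber ∘ encode) (words n)) k
      ≡⟨ cong (λ ps → coeff (sumₚ ps) k)
           (List.map-cong-local (All.tabulate λ w∈ → cong x^_ (forcingNumber-encode (words-valid n w∈)))) ⟩
    coeff (enumerator (λ w → n + mids w) (words n)) k
      ≡⟨ enumerator-shift n mids (words n) k ⟩
    shift n (count n) k ∎
    where open ≡-Reasoning

module _ (hs : List Hexagon)
  (∈hs⁻ : ∀ {h} → h ∈ₗ hs → ∃ λ (i : Fin (suc n)) → h ∈ₗ cells (quad (toℕ i)))
  (∈hs⁺ : ∀ {h} (i : Fin (suc n)) → h ∈ₗ cells (quad (toℕ i)) → h ∈ₗ hs)
  where

  open HexagonalSystem hs using (graph)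
  open Graph graph using (Edge; ends; edges; vertices; ends∈vertices)
  open Forcing graph

  private
    collect⁻ : ∀ {A : Set} (f : Hexagon → List A) {y} → y ∈ₗ concatMap f hs →
      ∃ λ (i : Fin (suc n)) → y ∈ₗ concatMap f (cells (quad (toℕ i)))
    collect⁻ f y∈ with find (∈-concatMap⁻ f y∈)
    ... | h , h∈ , y∈h with ∈hs⁻ h∈
    ...   | i , h∈i = i , ∈-concatMap⁺ f (lose h∈i y∈h)

    collect⁺ : ∀ {A : Set} (f : Hexagon → List A) {y} (i : Fin (suc n)) → y ∈ₗ concatMap f (cells (quad (toℕ i))) →
      y ∈ₗ concatMap f hs
    collect⁺ f i y∈ with find (∈-concatMap⁻ f y∈)
    ... | h , h∈i , y∈h = ∈-concatMap⁺ f (lose (∈hs⁺ i h∈i) y∈h)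

    abstract
      segment∈edges : (x : Bond (suc n)) → segment x ∈ₗ edges
      segment∈edges x with segment∈ x
      ... | i , x∈ = ∈-deduplicate⁺ (≡-dec _≟ₚ_ _≟ₚ_) (collect⁺ hexEdges i x∈)

      named : ∀ e → ∃ λ (x : Bond (suc n)) → ends e ≡ segment x
      named e with collect⁻ hexEdges (∈-deduplicate⁻ (≡-dec _≟ₚ_ _≟ₚ_) (concatMap hexEdges hs) (∈-lookup e))
      ... | i , e∈ = All.lookup (cellBonds i) e∈

      vertex-point : ∀ {v} → v ∈ₗ vertices → ∃ λ (u : Node (suc n)) → v ≡ point u
      vertex-point v∈ with collect⁻ hexVertices (∈-deduplicate⁻ _≟ₚ_ (concatMap hexVertices hs) v∈)
      ... | i , v∈i = All.lookup (cellNodes i) v∈i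

  edge : Bond (suc n) → Edge
  edge x = Any.index (segment∈edges x)

  name : Edge → Bond (suc n)
  name e = proj₁ (named e)

  ends-name : ∀ e → ends e ≡ segment (name e)
  ends-name e = proj₂ (named e)

  ends-edge : ∀ x → ends (edge x) ≡ segment x
  ends-edge x = sym (Any.lookup-index (segment∈edges x))

  name-edge : ∀ x → name (edge x) ≡ x
  name-edge x = segment-injective (trans (sym (ends-name (edge x))) (ends-edge x))

  name-injective : ∀ {e e′} → name e ≡ name e′ → e ≡ e′
  name-injective {e} {e′} eq =
    Graph.no-parallel graph e e′ (inj₁ (trans (ends-name e) (trans (cong segment eq) (sym (ends-name e′)))))

  edge-name : ∀ e → edge (name e) ≡ e
  edge-name e = name-injective (name-edge (name e))

  incident⁺ : ∀ {u : Node (suc n)} {e} → Inc u (name e) → Incident (point u) e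
  incident⁺ {u} {e} inc with inc⁻ inc
  ... | inj₁ eq = inj₁ (trans (cong point eq) (sym (cong proj₁ (ends-name e))))
  ... | inj₂ eq = inj₂ (trans (cong point eq) (sym (cong proj₂ (ends-name e))))

  incident⁻ : ∀ {u : Node (suc n)} {e} → Incident (point u) e → Inc u (name e)
  incident⁻ {e = e} (inj₁ eq) = subst (λ u → Inc u (name e))
    (sym (point-injective (trans eq (cong proj₁ (ends-name e))))) (inc-source (name e))
  incident⁻ {e = e} (inj₂ eq) = subst (λ u → Inc u (name e))
    (sym (point-injective (trans eq (cong proj₂ (ends-name e))))) (inc-target (name e))

  point∈vertices : (u : Node (suc n)) → point u ∈ₗ vertices
  point∈vertices u with bondAt u
    where
    bondAt : (u : Node (suc n)) → ∃ (Inc u)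
    bondAt (bd k s)    = _ , bdB
    bondAt (inn s i h) = _ , innR
    bondAt (tip s i h) = _ , tipR
    bondAt (ctr s i)   = _ , ctrM
    bondAt (apex s i)  = cap s i left , apexC
  ... | x , inc with incident⁺ {e = edge x} (subst (Inc u) (sym (name-edge x)) inc)
  ...   | inj₁ eq = subst (_∈ₗ vertices) (sym eq) (proj₁ (ends∈vertices (edge x)))
  ...   | inj₂ eq = subst (_∈ₗ vertices) (sym eq) (proj₂ (ends∈vertices (edge x)))

  labelling : Labelling graph (suc n)
  labelling = record
    { position = point ; vertex-node = vertex-point ; node∈vertices = point∈vertices
    ; edge = edge ; name = name ; name-edge = name-edge ; edge-name = edge-name
    ; incident⁺ = incident⁺ ; incident⁻ = incident⁻
    }

pyrene-labelling : ∀ n → Labelling (pyrene (suc n)) (suc n)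
pyrene-labelling n = labelling (concatMap fragment (upTo (suc n))) ∈hs⁻ ∈hs⁺
  where
  ∈hs⁻ : ∀ {h} → h ∈ₗ concatMap fragment (upTo (suc n)) → ∃ λ (i : Fin (suc n)) → h ∈ₗ cells (quad (toℕ i))
  ∈hs⁻ {h} h∈ with find (∈-concatMap⁻ fragment {xs = upTo (suc n)} h∈)
  ... | i , i∈ , h∈i = Fin.fromℕ< i<n , subst (h ∈ₗ_)
    (trans (fragment≡cells i) (cong (cells ∘ quad) (sym (Fin.toℕ-fromℕ< i<n)))) h∈i
    where i<n = ∈-upTo⁻ i∈
  ∈hs⁺ : ∀ {h} (i : Fin (suc n)) → h ∈ₗ cells (quad (toℕ i)) → h ∈ₗ concatMap fragment (upTo (suc n))
  ∈hs⁺ {h} i h∈ = ∈-concatMap⁺ fragment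
    (lose (∈-upTo⁺ (Fin.toℕ<n i)) (subst (h ∈ₗ_) (sym (fragment≡cells (toℕ i))) h∈))

theorem3p2 : (n : ℕ) →
    forcingPolynomial (pyrene n)
    ≈ₚ x^ n *ₚ ∑[ 0 ⋯ n ] (λ j → ∑[ ⌈ j + n /2⌉ ⋯ n ] (λ i →
    ((-1ℤ ^ᶻ (n ∸ i)) *ᶻ ((+ 2) ^ᶻ (2 * i + j ∸ n)) *ᶻ (+ (i C (n ∸ i))) *ᶻ (+ ((2 * i ∸ n) C j))) ·ₚ x^ j))
theorem3p2 zero    zero    = refl
theorem3p2 zero    (suc _) = refl
theorem3p2 (suc n) k       = begin
  coeff (forcingPolynomial (pyrene (suc n))) k
    ≡⟨ forcingPolynomial-count (pyrene-labelling n) k ⟩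
  shift (suc n) (count (suc n)) k
    ≡⟨ shift-cong (suc n) (λ j → trans (count≡total (suc n) j) (sym (coeff-closedForm (suc n) j))) k ⟩
  shift (suc n) (coeff (closedForm (suc n))) k
    ≡⟨ coeff-x^-*ₚ (suc n) (closedForm (suc n)) k ⟨
  coeff (x^ suc n *ₚ closedForm (suc n)) k ∎
  where open ≡-Reasoning
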